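{- Let $n\ge 4$ be an integer, and let $w,u:[n]^{(2)}\to\mathbb R$ satisfy $w([n])=u([n])=0$. Then $\operatorname{disc}(w,u)=0$ if and only if all three of the following conditions hold: (i) $h_w^+=0$ or $h_u^+=0$; (ii) $h_w^-=0$ or $h_u^-=0$; (iii) $\operatorname{tr}(\Gamma_w\Gamma_u)=0$, equivalently $\operatorname{col}(\Gamma_w)\perp\operatorname{col}(\Gamma_u)$ in $\mathbb R^2$. Consequently, if $\mathcal F$ is a pairwise zero-discrepant family of nonzero centered weight functions on $[n]$, then $$\sum_{w\in\mathcal F}\Bigl(\operatorname{rank}(\Gamma_w)+\mathbf 1_{\{h_w^+\ne0\}}+\mathbf 1_{\{h_w^-\ne0\}}\Bigr)\le 4,$$ and hence $|\mathcal F|\le 4$.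
   Context: Write $[n]=\{1,\dots,n\}$ and $[n]^{(2)}=\{(x,y)\in[n]\times[n]:x\ne y\}$. A weight function on $[n]$ is a function $w:[n]^{(2)}\to\mathbb R$, with values written $w_{xy}$ or $w(x,y)$. Put $\langle w,u\rangle=\sum_{x\ne y}w_{xy}u_{xy}$, $w([n])=\sum_{x\ne y}w_{xy}$, $d(w)=w([n])/(n(n-1))$; $w$ is centered if $w([n])=0$. For $\pi\in S_n$ the relabelling $w_\pi$ is $(w_\pi)_{xy}=w_{\pi^{ -1}(x)\pi^{ -1}(y)}$. Define $$\operatorname{disc}^+(w,u)=\max_{\pi\in S_n}\langle w_\pi,u\rangle-d(w)d(u)n(n-1),\qquad \operatorname{disc}^-(w,u)=d(w)d(u)n(n-1)-\min_{\pi\in S_n}\langle w_\pi,u\rangle,$$ and $\operatorname{disc}(w,u)=\max\{\operatorname{disc}^+(w,u),\operatorname{disc}^-(w,u)\}$. A family (set) $\mathcal F$ of weight functions is pairwise zero-discrepant if $\operatorname{disc}(w,u)=0$ for all distinct $w,u\in\mathcal F$. For $x\in[n]$ let $r_x(w)=\sum_{y\ne x}w_{xy}$, $c_x(w)=\sum_{y\ne x}w_{yx}$, $$p_x(w)=\frac{r_x(w)+c_x(w)}{2(n-2)},\qquad q_x(w)=\frac{r_x(w)-c_x(w)}{2n}.$$ For $x\ne y$ let $g_w^+(x,y)=p_x(w)+p_y(w)$, $g_w^-(x,y)=q_x(w)-q_y(w)$, and $h_w=w-g_w^+-g_w^-$. With $f^{\mathsf T}(x,y)=f(y,x)$, let $h_w^+=(h_w+h_w^{\mathsf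 T})/2$ and $h_w^-=(h_w-h_w^{\mathsf T})/2$. For centered $w$ let $\alpha_w=\sqrt{2(n-2)}\,(p_1(w),\dots,p_n(w))\in\mathbb R^n$, $\beta_w=\sqrt{2n}\,(q_1(w),\dots,q_n(w))\in\mathbb R^n$, and $$\Gamma_w=\begin{pmatrix}\|\alpha_w\|_2^2&\langle\alpha_w,\beta_w\rangle\\ \langle\alpha_w,\beta_w\rangle&\|\beta_w\|_2^2\end{pmatrix}.$$ $\operatorname{col}(\Gamma)$ denotes the column space of the matrix $\Gamma$, and $\mathbf 1_{\{\cdot\}}$ is $1$ if the condition holds and $0$ otherwise. -}

module Defs where

open import Algebra.Bundles using (CommutativeRing; CommutativeSemiring)
open import Algebra.Structures using (IsCommutativeRing)
open import Data.Empty using (⊥-elim)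
open import Data.Fin.Base using (Fin; zero; suc; punchIn)
open import Data.Fin.Patterns using (0F; 1F)
open import Data.Fin.Properties using (any?; all?) renaming (_≟_ to _≟ᶠ_)
open import Data.Fin.Permutation as Perm
  using (Permutation′; _⟨$⟩ʳ_; _⟨$⟩ˡ_; inverseʳ; insert; remove)
open import Data.List.Base as List using (List; []; allFin; cartesianProductWith)
open import Data.List.Relation.Unary.All using (All)
open import Data.List.Relation.Unary.AllPairs using (AllPairs)
open import Data.List.Relation.Unary.Any as Any using (Any; here)
open import Data.List.Relation.Unary.Any.Properties using (cartesianProductWith⁺)
open import Data.List.Membership.Propositional.Properties using (∈-allFin)
open import Data.Nat.Base as ℕ using (ℕ; zero; suc)
open import Data.Product using (∃; _×_; _,_; proj₁; proj₂)
open import Data.Sum using (_⊎_; inj₁; inj₂; [_,_]′)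
open import Data.Vec.Functional using (Vector; _∷_; tail; transpose)
open import Function.Base using (_∘_; const; id)
import Level
open import Relation.Binary.Core using (Rel)
open import Relation.Binary.Bundles using (TotalOrder)
open import Relation.Binary.Definitions using (Decidable)
open import Relation.Binary.Structures using (IsDecTotalOrder)
open import Relation.Binary.PropositionalEquality as ≡ using (_≡_; _≢_; ≢-sym)
open import Relation.Nullary using (¬_; Dec; yes; no; ¬?)
open import Relation.Nullary.Decidable using (decidable-stable)
open import Relation.Unary using (Pred; _∈_)

import Algebra.Construct.NaturalChoice.Max as Max
import Algebra.Properties.Monoid.Mult as Mult
import Algebra.Properties.Ring as RingProperties
import Algebra.Properties.Semiring.Sum as Sum
import Algebra.Solver.Ring.NaturalCoefficients.Default as Solver
import Data.List.Extrema as Extrema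
import Data.Nat.ListAction as ListAction
import Relation.Binary.Reasoning.Setoid as SetoidReasoning

-- The real numbers, given by the axioms that characterise them classically up
-- to isomorphism: a nontrivial, totally ordered, Dedekind complete field. As in
-- the classical theory, the order is decidable.

record RealNumbers ℓ : Set (Level.suc ℓ) where
  infix  4 _≈_ _≤_
  infixl 6 _+_
  infixl 7 _*_
  infix  8 -_
  field
    Carrier           : Set ℓ
    _≈_ _≤_           : Rel Carrier ℓ
    _+_ _*_           : Carrier → Carrier → Carrier
    -_                : Carrier → Carrier
    0# 1#             : Carrier
    isCommutativeRing : IsCommutativeRing _≈_ _+_ _*_ -_ 0# 1#
    isDecTotalOrder   : IsDecTotalOrder _≈_ _≤_
    1≉0               : ¬ (1# ≈ 0#)
    inverse           : ∀ x → ¬ (x ≈ 0#) → ∃ λ y → x * y ≈ 1#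
    +-monoʳ-≤         : ∀ x {y z} → y ≤ z → x + y ≤ x + z
    *-nonNeg          : ∀ {x y} → 0# ≤ x → 0# ≤ y → 0# ≤ x * y

  IsUpperBound : Pred Carrier ℓ → Carrier → Set ℓ
  IsUpperBound P b = ∀ {x} → P x → x ≤ b

  field
    supremum : (P : Pred Carrier ℓ) → ∃ P → ∃ (IsUpperBound P) →
               ∃ λ s → IsUpperBound P s × (∀ {b} → IsUpperBound P b → s ≤ b)

  commutativeRing : CommutativeRing ℓ ℓ
  commutativeRing = record { isCommutativeRing = isCommutativeRing }

  totalOrder : TotalOrder ℓ ℓ ℓ
  totalOrder = record { isTotalOrder = IsDecTotalOrder.isTotalOrder isDecTotalOrder }

private
  module SquareRootIdentities {a b} (S : CommutativeSemiring a b) where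
    open CommutativeSemiring S
    open Solver S using (solve; _:+_; _:*_; _:=_)
    open SetoidReasoning setoid

    square-1+ : ∀ a → (1# + a) * (1# + a) ≈ a + (1# + a + a * a)
    square-1+ a = begin
      (1# + a) * (1# + a)
        ≈⟨ solve 2 (λ o a → (o :+ a) :* (o :+ a) :=
             o :* o :+ o :* a :+ (o :* a :+ a :* a)) refl 1# a ⟩
      1# * 1# + 1# * a + (1# * a + a * a)
        ≈⟨ +-cong (+-cong (*-identityˡ 1#) (*-identityˡ a)) (+-congʳ (*-identityˡ a)) ⟩
      1# + a + (a + a * a)
        ≈⟨ solve 2 (λ o a → o :+ a :+ (a :+ a :* a) := a :+ (o :+ a :+ a :* a)) refl 1# a ⟩
      a + (1# + a + a * a) ∎

    square-product : ∀ x y → x * x * (y * y) ≈ x * y * (x * y)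
    square-product = solve 2 (λ x y → x :* x :* (y :* y) := x :* y :* (x :* y)) refl

    module _ (a s c d e : Carrier) (cc≈a+e : c * c ≈ a + e) where

      above : s * s ≈ a + d →
              (a + s * c) * (a + s * c) ≈ a * ((s + c) * (s + c)) + d * e
      above ss≈a+d = begin
        (a + s * c) * (a + s * c)
          ≈⟨ solve 3 (λ a s c → (a :+ s :* c) :* (a :+ s :* c) :=
               a :* a :+ (a :* s :* c :+ a :* s :* c) :+ s :* s :* (c :* c)) refl a s c ⟩
        a * a + (a * s * c + a * s * c) + s * s * (c * c)
          ≈⟨ +-congˡ (*-congʳ ss≈a+d) ⟩
        a * a + (a * s * c + a * s * c) + (a + d) * (c * c)
          ≈⟨ solve 4 (λ a s c d → a :* a :+ (a :* s :* c :+ a :* s :* c) :+ (a :+ d) :* (c :* c) :=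
               a :* a :+ (a :* s :* c :+ a :* s :* c) :+ a :* (c :* c) :+ d :* (c :* c)) refl a s c d ⟩
        a * a + (a * s * c + a * s * c) + a * (c * c) + d * (c * c)
          ≈⟨ +-congˡ (*-congˡ cc≈a+e) ⟩
        a * a + (a * s * c + a * s * c) + a * (c * c) + d * (a + e)
          ≈⟨ solve 5 (λ a s c d e →
               a :* a :+ (a :* s :* c :+ a :* s :* c) :+ a :* (c :* c) :+ d :* (a :+ e) :=
               a :* (a :+ d) :+ (a :* s :* c :+ a :* s :* c) :+ a :* (c :* c) :+ d :* e) refl a s c d e ⟩
        a * (a + d) + (a * s * c + a * s * c) + a * (c * c) + d * e
          ≈⟨ +-congʳ (+-congʳ (+-congʳ (*-congˡ ss≈a+d))) ⟨
        a * (s * s) + (a * s * c + a * s * c) + a * (c * c) + d * e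
          ≈⟨ solve 5 (λ a s c d e →
               a :* (s :* s) :+ (a :* s :* c :+ a :* s :* c) :+ a :* (c :* c) :+ d :* e :=
               a :* ((s :+ c) :* (s :+ c)) :+ d :* e) refl a s c d e ⟩
        a * ((s + c) * (s + c)) + d * e ∎

      below : a ≈ s * s + d →
              a * ((s + c) * (s + c)) ≈ (a + s * c) * (a + s * c) + d * e
      below a≈ss+d = begin
        a * ((s + c) * (s + c))
          ≈⟨ solve 3 (λ a s c → a :* ((s :+ c) :* (s :+ c)) :=
               a :* (c :* c) :+ (a :* s :* c :+ a :* s :* c) :+ a :* (s :* s)) refl a s c ⟩
        a * (c * c) + (a * s * c + a * s * c) + a * (s * s)
          ≈⟨ +-congʳ (+-congʳ (*-congʳ a≈ss+d)) ⟩
        (s * s + d) * (c * c) + (a * s * c + a * s * c) + a * (s * s)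
          ≈⟨ solve 4 (λ a s c d →
               (s :* s :+ d) :* (c :* c) :+ (a :* s :* c :+ a :* s :* c) :+ a :* (s :* s) :=
               s :* s :* (c :* c) :+ (a :* s :* c :+ a :* s :* c) :+ a :* (s :* s) :+ d :* (c :* c)) refl a s c d ⟩
        s * s * (c * c) + (a * s * c + a * s * c) + a * (s * s) + d * (c * c)
          ≈⟨ +-congˡ (*-congˡ cc≈a+e) ⟩
        s * s * (c * c) + (a * s * c + a * s * c) + a * (s * s) + d * (a + e)
          ≈⟨ solve 5 (λ a s c d e →
               s :* s :* (c :* c) :+ (a :* s :* c :+ a :* s :* c) :+ a :* (s :* s) :+ d :* (a :+ e) :=
               s :* s :* (c :* c) :+ (a :* s :* c :+ a :* s :* c) :+ a :* (s :* s :+ d) :+ d :* e) refl a s c d e ⟩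
        s * s * (c * c) + (a * s * c + a * s * c) + a * (s * s + d) + d * e
          ≈⟨ +-congʳ (+-congˡ (*-congˡ a≈ss+d)) ⟨
        s * s * (c * c) + (a * s * c + a * s * c) + a * a + d * e
          ≈⟨ solve 5 (λ a s c d e →
               s :* s :* (c :* c) :+ (a :* s :* c :+ a :* s :* c) :+ a :* a :+ d :* e :=
               (a :+ s :* c) :* (a :+ s :* c) :+ d :* e) refl a s c d e ⟩
        (a + s * c) * (a + s * c) + d * e ∎

module RealArithmetic {ℓ} (R : RealNumbers ℓ) where

  open RealNumbers R public
    hiding (_≈_; _+_; _*_; -_; 0#; 1#)
    renaming (Carrier to ℝ)
  open CommutativeRing commutativeRing public
    using (_≈_; _+_; _*_; -_; _-_; 0#; 1#; ring; semiring; commutativeSemiring; setoid)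
  open IsDecTotalOrder isDecTotalOrder public using (_≟_; _≤?_)
  open Sum semiring public using (sum; sum-syntax)
  open Max totalOrder public using () renaming (_⊔_ to _⊔ᵣ_)

  private
    open module CR = CommutativeRing commutativeRing
      hiding (_≈_; _+_; _*_; -_; _-_; 0#; 1#; ring; semiring; commutativeSemiring; setoid; Carrier)
    open module O = IsDecTotalOrder isDecTotalOrder
      using (antisym; total; ≤-respˡ-≈; ≤-respʳ-≈)
      renaming (refl to ≤-refl; reflexive to ≤-reflexive; trans to ≤-trans)
    open RingProperties ring
    open SquareRootIdentities commutativeSemiring

  infixl 7 _/_
  infix  8 _⁻¹

  -- With the convention 0 ⁻¹ = 0.
  _⁻¹ : ℝ → ℝ
  x ⁻¹ with x ≟ 0#
  ... | yes _   = 0#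
  ... | no  x≉0 = proj₁ (inverse x x≉0)

  *-inverseʳ : ∀ {x} → ¬ (x ≈ 0#) → x * x ⁻¹ ≈ 1#
  *-inverseʳ {x} x≉0 with x ≟ 0#
  ... | yes x≈0  = ⊥-elim (x≉0 x≈0)
  ... | no  x≉0′ = proj₂ (inverse x x≉0′)

  _/_ : ℝ → ℝ → ℝ
  x / y = x * y ⁻¹

  ⌜_⌝ : ℕ → ℝ
  ⌜ n ⌝ = Mult._×_ +-monoid n 1#

  private
    difference : ∀ {x y} → x ≤ y → ∃ λ d → 0# ≤ d × y ≈ x + d
    difference {x} {y} x≤y =
      - x + y ,
      ≤-respˡ-≈ (-‿inverseˡ x) (+-monoʳ-≤ (- x) x≤y) ,
      sym (trans (sym (+-assoc x (- x) y))
                 (trans (+-congʳ (-‿inverseʳ x)) (+-identityˡ y)))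

    x≤x+d : ∀ {x d} → 0# ≤ d → x ≤ x + d
    x≤x+d {x} 0≤d = ≤-respˡ-≈ (+-identityʳ x) (+-monoʳ-≤ x 0≤d)

    +-nonNeg : ∀ {x y} → 0# ≤ x → 0# ≤ y → 0# ≤ x + y
    +-nonNeg 0≤x 0≤y = ≤-trans 0≤x (x≤x+d 0≤y)

    +-cancelˡ-≤ : ∀ z {x y} → z + x ≤ z + y → x ≤ y
    +-cancelˡ-≤ z {x} {y} p = ≤-respˡ-≈ (e x) (≤-respʳ-≈ (e y) (+-monoʳ-≤ (- z) p))
      where
      e : ∀ w → - z + (z + w) ≈ w
      e w = trans (sym (+-assoc _ _ _)) (trans (+-congʳ (-‿inverseˡ z)) (+-identityˡ w))

    *-monoˡ-≤ : ∀ {x y z} → 0# ≤ z → x ≤ y → x * z ≤ y * z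
    *-monoˡ-≤ {x} {y} {z} 0≤z x≤y with difference x≤y
    ... | d , 0≤d , y≈x+d =
      ≤-respʳ-≈ (trans (sym (distribʳ z x d)) (*-congʳ (sym y≈x+d)))
                (x≤x+d (*-nonNeg 0≤d 0≤z))

    noZeroDivisors : ∀ {x y} → ¬ (y ≈ 0#) → x * y ≈ 0# → x ≈ 0#
    noZeroDivisors {x} {y} y≉0 xy≈0 = begin
      x                 ≈⟨ *-identityʳ x ⟨
      x * 1#            ≈⟨ *-congˡ (*-inverseʳ y≉0) ⟨
      x * (y * y ⁻¹)    ≈⟨ *-assoc x y _ ⟨
      x * y * y ⁻¹      ≈⟨ *-congʳ xy≈0 ⟩
      0# * y ⁻¹         ≈⟨ zeroˡ _ ⟩
      0#                ∎
      where open SetoidReasoning setoid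

    *-cancelʳ-≤ : ∀ {x y z} → 0# ≤ z → ¬ (z ≈ 0#) → x * z ≤ y * z → x ≤ y
    *-cancelʳ-≤ {x} {y} {z} 0≤z z≉0 xz≤yz with total x y
    ... | inj₁ x≤y = x≤y
    ... | inj₂ y≤x with difference y≤x
    ...   | d , 0≤d , x≈y+d = ≤-reflexive (trans x≈y+d (trans (+-congˡ d≈0) (+-identityʳ y)))
      where
      dz≤0 : d * z ≤ 0#
      dz≤0 = +-cancelˡ-≤ (y * z) (≤-respʳ-≈ (sym (+-identityʳ _))
               (≤-respˡ-≈ (trans (*-congʳ x≈y+d) (distribʳ z y d)) xz≤yz))
      d≈0 : d ≈ 0#
      d≈0 = noZeroDivisors z≉0 (antisym dz≤0 (*-nonNeg 0≤d 0≤z))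

    0≤1 : 0# ≤ 1#
    0≤1 with total 0# 1#
    ... | inj₁ 0≤1 = 0≤1
    ... | inj₂ 1≤0 with difference 1≤0
    ...   | d , 0≤d , 0≈1+d = ≤-respʳ-≈ dd≈1 (*-nonNeg 0≤d 0≤d)
      where
      open SetoidReasoning setoid
      dd≈1 : d * d ≈ 1#
      dd≈1 = begin
        d * d                    ≈⟨ +-identityʳ _ ⟨
        d * d + 0#               ≈⟨ +-congˡ 0≈1+d ⟩
        d * d + (1# + d)         ≈⟨ +-congˡ (+-comm 1# d) ⟩
        d * d + (d + 1#)         ≈⟨ +-assoc _ _ _ ⟨
        d * d + d + 1#           ≈⟨ +-congʳ (+-congˡ (*-identityʳ d)) ⟨
        d * d + d * 1# + 1#      ≈⟨ +-congʳ (distribˡ d d 1#) ⟨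
        d * (d + 1#) + 1#        ≈⟨ +-congʳ (*-congˡ (trans (+-comm d 1#) (sym 0≈1+d))) ⟩
        d * 0# + 1#              ≈⟨ +-congʳ (zeroʳ d) ⟩
        0# + 1#                  ≈⟨ +-identityˡ 1# ⟩
        1#                       ∎

    square-cancel-≤ : ∀ {x y} → 0# ≤ y → x * x ≤ y * y → x ≤ y
    square-cancel-≤ {x} {y} 0≤y xx≤yy with x ≤? y
    ... | yes x≤y = x≤y
    ... | no  x≰y = *-cancelʳ-≤ 0≤x x≉0 (≤-trans xx≤yy (≤-respʳ-≈ (*-comm x y) (*-monoˡ-≤ 0≤y y≤x)))
      where
      y≤x : y ≤ x
      y≤x with total x y
      ... | inj₁ x≤y = ⊥-elim (x≰y x≤y)
      ... | inj₂ y≤x = y≤x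
      0≤x : 0# ≤ x
      0≤x = ≤-trans 0≤y y≤x
      x≉0 : ¬ (x ≈ 0#)
      x≉0 x≈0 = x≰y (≤-respˡ-≈ (sym x≈0) 0≤y)

  -- The supremum s of the y with y * y ≤ a is compared with
  -- f = (a + s c) / (s + c), where c = 1 + a: the difference f * f - a has the
  -- sign of s * s - a, and f - s has the opposite sign.
  squareRoot : ∀ a → 0# ≤ a → ∃ λ s → 0# ≤ s × s * s ≈ a
  squareRoot a 0≤a = s , 0≤s , antisym ss≤a a≤ss
    where
    c = 1# + a
    e = 1# + a + a * a

    P : Pred ℝ ℓ
    P y = y * y ≤ a

    0≤c : 0# ≤ c
    0≤c = +-nonNeg 0≤1 0≤a

    0≤e : 0# ≤ e
    0≤e = +-nonNeg 0≤c (*-nonNeg 0≤a 0≤a)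

    cc≈a+e : c * c ≈ a + e
    cc≈a+e = square-1+ a

    P-bounded : IsUpperBound P c
    P-bounded Py = square-cancel-≤ 0≤c
      (≤-trans Py (≤-respʳ-≈ (sym cc≈a+e) (x≤x+d 0≤e)))

    0∈P : P 0#
    0∈P = ≤-respˡ-≈ (sym (zeroˡ 0#)) 0≤a

    sup = supremum P (0# , 0∈P) (c , P-bounded)
    s = proj₁ sup

    upper : IsUpperBound P s
    upper = proj₁ (proj₂ sup)

    least : ∀ {b} → IsUpperBound P b → s ≤ b
    least = proj₂ (proj₂ sup)

    0≤s : 0# ≤ s
    0≤s = upper 0∈P

    N = a + s * c
    D = s + c
    f = N / D

    0≤D : 0# ≤ D
    0≤D = +-nonNeg 0≤s 0≤c

    1≤D : 1# ≤ D
    1≤D = ≤-trans (x≤x+d 0≤a) (≤-respʳ-≈ (+-comm c s) (x≤x+d 0≤s))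

    D≉0 : ¬ (D ≈ 0#)
    D≉0 D≈0 = 1≉0 (antisym (≤-respʳ-≈ D≈0 1≤D) 0≤1)

    0≤N : 0# ≤ N
    0≤N = +-nonNeg 0≤a (*-nonNeg 0≤s 0≤c)

    fD≈N : f * D ≈ N
    fD≈N = begin
      N * D ⁻¹ * D    ≈⟨ *-assoc N _ D ⟩
      N * (D ⁻¹ * D)  ≈⟨ *-congˡ (*-comm _ D) ⟩
      N * (D * D ⁻¹)  ≈⟨ *-congˡ (*-inverseʳ D≉0) ⟩
      N * 1#          ≈⟨ *-identityʳ N ⟩
      N               ∎
      where open SetoidReasoning setoid

    0≤f : 0# ≤ f
    0≤f = *-cancelʳ-≤ 0≤D D≉0
      (≤-respʳ-≈ (sym fD≈N) (≤-respˡ-≈ (sym (zeroˡ D)) 0≤N))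

    0≤DD : 0# ≤ D * D
    0≤DD = *-nonNeg 0≤D 0≤D

    DD≉0 : ¬ (D * D ≈ 0#)
    DD≉0 DD≈0 = D≉0 (noZeroDivisors D≉0 DD≈0)

    ffDD≈NN : f * f * (D * D) ≈ N * N
    ffDD≈NN = trans (square-product f D) (*-cong fD≈N fD≈N)

    sD≈ : s * D ≈ s * c + s * s
    sD≈ = trans (distribˡ s s c) (+-comm (s * s) (s * c))

    N≈ : N ≈ s * c + a
    N≈ = +-comm a (s * c)

    above⇒≤ : ∀ d → 0# ≤ d → s * s ≈ a + d → s * s ≤ a
    above⇒≤ d 0≤d ss≈a+d = +-cancelˡ-≤ (s * c) (≤-respˡ-≈ sD≈ (≤-respʳ-≈ (trans fD≈N N≈)
      (*-monoˡ-≤ 0≤D (least λ Py → square-cancel-≤ 0≤f (≤-trans Py a≤ff)))))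
      where
      a≤ff : a ≤ f * f
      a≤ff = *-cancelʳ-≤ 0≤DD DD≉0
        (≤-respʳ-≈ (sym (trans ffDD≈NN (above a s c d e cc≈a+e ss≈a+d)))
                   (x≤x+d (*-nonNeg 0≤d 0≤e)))

    below⇒≥ : ∀ d → 0# ≤ d → a ≈ s * s + d → a ≤ s * s
    below⇒≥ d 0≤d a≈ss+d = +-cancelˡ-≤ (s * c) (≤-respʳ-≈ sD≈ (≤-respˡ-≈ (trans fD≈N N≈)
      (*-monoˡ-≤ 0≤D (upper ff≤a))))
      where
      ff≤a : f * f ≤ a
      ff≤a = *-cancelʳ-≤ 0≤DD DD≉0
        (≤-respˡ-≈ (sym ffDD≈NN) (≤-respʳ-≈ (sym (below a s c d e cc≈a+e a≈ss+d))
                   (x≤x+d (*-nonNeg 0≤d 0≤e))))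

    ss≤a : s * s ≤ a
    ss≤a = [ id , (λ a≤ss → let d , 0≤d , eq = difference a≤ss in above⇒≤ d 0≤d eq) ]′
             (total (s * s) a)

    a≤ss : a ≤ s * s
    a≤ss = [ id , (λ ss≤a → let d , 0≤d , eq = difference ss≤a in below⇒≥ d 0≤d eq) ]′
             (total a (s * s))

  -- With the convention √ x = 0 for x < 0.
  √_ : ℝ → ℝ
  √ x with 0# ≤? x
  ... | yes 0≤x = proj₁ (squareRoot x 0≤x)
  ... | no  _   = 0#

  √-nonNeg : ∀ x → 0# ≤ √ x
  √-nonNeg x with 0# ≤? x
  ... | yes 0≤x = proj₁ (proj₂ (squareRoot x 0≤x))
  ... | no  _   = ≤-refl

  √-square : ∀ {x} → 0# ≤ x → √ x * √ x ≈ x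
  √-square {x} 0≤x with 0# ≤? x
  ... | yes 0≤x′ = proj₂ (proj₂ (squareRoot x 0≤x′))
  ... | no  0≰x  = ⊥-elim (0≰x 0≤x)

module LinearAlgebra {ℓ} (R : RealNumbers ℓ) where

  open RealArithmetic R

  private
    open module CR = CommutativeRing commutativeRing
      hiding (_≈_; _+_; _*_; -_; _-_; 0#; 1#; ring; semiring; commutativeSemiring; setoid; zero; Carrier)
    open RingProperties ring
    open module Σ = Sum semiring using (sum-cong-≋; *-distribʳ-sum; ∑-distrib-+; sum-replicate-zero)
    open SetoidReasoning setoid

  dot : ∀ {n} → Vector ℝ n → Vector ℝ n → ℝ
  dot {n} u v = ∑[ i < n ] (u i * v i)

  linearCombination : ∀ {m r} → Vector ℝ r → Vector (Vector ℝ m) r → Vector ℝ m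
  linearCombination {r = r} c b i = ∑[ k < r ] (c k * b k i)

  Span : ∀ {m r} → Vector (Vector ℝ m) r → Pred (Vector ℝ m) ℓ
  Span b v = ∃ λ c → ∀ i → v i ≈ linearCombination c b i

  LinearlyIndependent : ∀ {m r} → Vector (Vector ℝ m) r → Set ℓ
  LinearlyIndependent b =
    ∀ c → (∀ i → linearCombination c b i ≈ 0#) → ∀ k → c k ≈ 0#

  record HasDimension {m} (V : Pred (Vector ℝ m) ℓ) (r : ℕ) : Set ℓ where
    field
      basis       : Vector (Vector ℝ m) r
      basis∈      : ∀ k → basis k ∈ V
      independent : LinearlyIndependent basis
      spanning    : ∀ {v} → v ∈ V → v ∈ Span basis

  private
    0*0 : ∀ {m r} (b : Vector (Vector ℝ m) r) i → linearCombination (const 0#) b i ≈ 0#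
    0*0 {r = r} b i = trans (sum-cong-≋ {r} (λ k → zeroˡ (b k i))) (sum-replicate-zero r)

    -- Gaussian elimination: b j = b′ j + t j u, where b′ j vanishes at i.
    module Elimination {m r} (u : Vector ℝ m) (b : Vector (Vector ℝ m) r)
                       (i : Fin m) (uᵢ≉0 : ¬ (u i ≈ 0#)) where

      t : Vector ℝ r
      t j = b j i / u i

      b′ : Vector (Vector ℝ m) r
      b′ j x = b j x - t j * u x

      b≈ : ∀ j x → b j x ≈ t j * u x + b′ j x
      b≈ j x = begin
        b j x                              ≈⟨ +-identityˡ _ ⟨
        0# + b j x                         ≈⟨ +-congʳ (-‿inverseʳ _) ⟨
        t j * u x - t j * u x + b j x      ≈⟨ +-assoc _ _ _ ⟩
        t j * u x + (- (t j * u x) + b j x) ≈⟨ +-congˡ (+-comm _ _) ⟩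
        t j * u x + b′ j x                 ∎

      b′ᵢ≈0 : ∀ j → b′ j i ≈ 0#
      b′ᵢ≈0 j = trans (+-congˡ (-‿cong tu≈b)) (-‿inverseʳ (b j i))
        where
        tu≈b : t j * u i ≈ b j i
        tu≈b = begin
          b j i * u i ⁻¹ * u i    ≈⟨ *-assoc _ _ _ ⟩
          b j i * (u i ⁻¹ * u i)  ≈⟨ *-congˡ (*-comm _ _) ⟩
          b j i * (u i * u i ⁻¹)  ≈⟨ *-congˡ (*-inverseʳ uᵢ≉0) ⟩
          b j i * 1#              ≈⟨ *-identityʳ _ ⟩
          b j i                   ∎

      combination : ∀ c x → linearCombination c b x ≈
                            dot c t * u x + linearCombination c b′ x
      combination c x = begin
        ∑[ j < r ] (c j * b j x)
          ≈⟨ sum-cong-≋ (λ j → trans (*-congˡ (b≈ j x)) (trans (distribˡ _ _ _) (+-congʳ (sym (*-assoc _ _ _))))) ⟩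
        ∑[ j < r ] (c j * t j * u x + c j * b′ j x)
          ≈⟨ ∑-distrib-+ (λ j → c j * t j * u x) (λ j → c j * b′ j x) ⟩
        ∑[ j < r ] (c j * t j * u x) + linearCombination c b′ x
          ≈⟨ +-congʳ (*-distribʳ-sum (u x) (λ j → c j * t j)) ⟨
        dot c t * u x + linearCombination c b′ x ∎

  dimension : ∀ {m r} (b : Vector (Vector ℝ m) r) → ∃ (HasDimension (Span b))
  dimension {r = zero} b = 0 , record
    { basis = b ; basis∈ = λ () ; independent = λ _ _ () ; spanning = id }
  dimension {r = suc r} b with any? (λ i → ¬? (b zero i ≟ 0#))
  ... | no u≈0 = proj₁ rec , record
    { basis       = basis
    ; basis∈      = λ k → let c , eq = basis∈ k in
                      (0# ∷ c) , λ i → trans (eq i) (sym (drop-u (0# ∷ c) i))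
    ; independent = independent
    ; spanning    = λ { (c , eq) → spanning (tail c , λ i → trans (eq i) (drop-u c i)) }
    }
    where
    rec = dimension (tail b)
    open HasDimension (proj₂ rec)
    drop-u : ∀ c i → linearCombination c b i ≈ linearCombination (tail c) (tail b) i
    drop-u c i = trans
      (+-congʳ (trans (*-congˡ (decidable-stable (b zero i ≟ 0#) λ uᵢ≉0 → u≈0 (i , uᵢ≉0)))
                      (zeroʳ (c zero))))
      (+-identityˡ _)
  ... | yes (i , uᵢ≉0) = suc (proj₁ rec) , record
    { basis       = u ∷ basis
    ; basis∈      = λ { zero    → (1# ∷ const 0#) , λ x → sym
                                    (trans (+-cong (*-identityˡ (u x)) (0*0 (tail b) x)) (+-identityʳ (u x)))
                      ; (suc k) → let c , eq = basis∈ k in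
                                  (- dot c t ∷ c) , λ x → trans (eq x) (uneliminate c x) }
    ; independent = λ c c≈0 →
        let c₀≈0 = c₀≈0 c (c≈0 i) in
        λ { zero    → c₀≈0
          ; (suc k) → independent (tail c)
                        (λ x → trans (sym (trans (+-congʳ (trans (*-congʳ c₀≈0) (zeroˡ (u x)))) (+-identityˡ _)))
                                     (c≈0 x)) k }
    ; spanning    = λ { (c , eq) →
        let c′ , eq′ = spanning {linearCombination (tail c) b′} (tail c , λ _ → refl) in
        (c zero + dot (tail c) t ∷ c′) , λ x → trans (eq x) (trans (eliminate c x) (+-congˡ (eq′ x))) }
    }
    where
    u = b zero
    open Elimination u (tail b) i uᵢ≉0
    rec = dimension b′
    open HasDimension (proj₂ rec)

    eliminate : ∀ c x → linearCombination c b x ≈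
                (c zero + dot (tail c) t) * u x + linearCombination (tail c) b′ x
    eliminate c x = begin
      c zero * u x + linearCombination (tail c) (tail b) x
        ≈⟨ +-congˡ (combination (tail c) x) ⟩
      c zero * u x + (dot (tail c) t * u x + linearCombination (tail c) b′ x)
        ≈⟨ +-assoc _ _ _ ⟨
      c zero * u x + dot (tail c) t * u x + linearCombination (tail c) b′ x
        ≈⟨ +-congʳ (distribʳ _ _ _) ⟨
      (c zero + dot (tail c) t) * u x + linearCombination (tail c) b′ x ∎

    uneliminate : ∀ c x → linearCombination c b′ x ≈ linearCombination (- dot c t ∷ c) b x
    uneliminate c x = sym (trans (eliminate (- dot c t ∷ c) x)
      (trans (+-congʳ (trans (*-congʳ (-‿inverseˡ (dot c t))) (zeroˡ (u x)))) (+-identityˡ _)))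

    basisᵢ≈0 : ∀ k → basis k i ≈ 0#
    basisᵢ≈0 k = let c , eq = basis∈ k in
      trans (eq i) (trans (sum-cong-≋ (λ j → trans (*-congˡ (b′ᵢ≈0 j)) (zeroʳ (c j))))
                          (sum-replicate-zero r))

    c₀≈0 : ∀ c → linearCombination c (u ∷ basis) i ≈ 0# → c zero ≈ 0#
    c₀≈0 c eq = begin
      c zero                     ≈⟨ *-identityʳ _ ⟨
      c zero * 1#                ≈⟨ *-congˡ (*-inverseʳ uᵢ≉0) ⟨
      c zero * (u i * u i ⁻¹)    ≈⟨ *-assoc _ _ _ ⟨
      c zero * u i * u i ⁻¹      ≈⟨ *-congʳ (+-identityʳ _) ⟨
      (c zero * u i + 0#) * u i ⁻¹
        ≈⟨ *-congʳ (+-congˡ (trans (sum-cong-≋ (λ k → trans (*-congˡ (basisᵢ≈0 k)) (zeroʳ (c (suc k)))))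
                                   (sum-replicate-zero (proj₁ rec)))) ⟨
      linearCombination c (u ∷ basis) i * u i ⁻¹
                                 ≈⟨ *-congʳ eq ⟩
      0# * u i ⁻¹                ≈⟨ zeroˡ _ ⟩
      0#                         ∎

  Matrix : ℕ → ℕ → Set ℓ
  Matrix m n = Vector (Vector ℝ n) m

  columnSpace : ∀ {m n} → Matrix m n → Pred (Vector ℝ m) ℓ
  columnSpace A = Span (transpose A)

  rank : ∀ {m n} → Matrix m n → ℕ
  rank A = proj₁ (dimension (transpose A))

  trace : ∀ {n} → Matrix n n → ℝ
  trace {n} A = ∑[ i < n ] A i i

  infixl 7 _⊗_
  _⊗_ : ∀ {l m n} → Matrix l m → Matrix m n → Matrix l n
  (A ⊗ B) i j = dot (A i) (transpose B j)

  infix 4 _⊥ₛ_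
  _⊥ₛ_ : ∀ {n} → Rel (Pred (Vector ℝ n) ℓ) ℓ
  V ⊥ₛ W = ∀ {v w} → v ∈ V → w ∈ W → dot v w ≈ 0#

-- Two elements of F that are pointwise equal count as the same element, so a
-- list of pairwise distinct elements of F represents a finite subset of F.
module Families {a ℓ p} {A : Set a} (_≈_ : Rel A ℓ) (F : Pred A p) where

  FiniteSubset : List A → Set _
  FiniteSubset xs = All (_∈ F) xs × AllPairs (λ x y → ¬ (x ≈ y)) xs

  -- A sum of natural numbers over F is at most m when all its finite partial
  -- sums are; no finiteness of F is presupposed.
  Sum≤ : (A → ℕ) → ℕ → Set _
  Sum≤ f m = ∀ xs → FiniteSubset xs → ListAction.sum (List.map f xs) ℕ.≤ m

  Cardinality≤ : ℕ → Set _
  Cardinality≤ m = ∀ xs → FiniteSubset xs → List.length xs ℕ.≤ m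

permutations : ∀ n → List (Permutation′ n)
permutations zero    = List.[ Perm.id ]
permutations (suc n) = cartesianProductWith (insert zero) (allFin (suc n)) (permutations n)

permutations-complete : ∀ {n} (π : Permutation′ n) → Any (Perm._≈ π) (permutations n)
permutations-complete {zero}  π = here λ ()
permutations-complete {suc n} π = cartesianProductWith⁺ (insert zero)
  (λ { {j} {σ} ≡.refl σ≈ k → ≡.trans (insert-cong j σ≈ k) (Perm.insert-remove zero π k) })
  (∈-allFin (π ⟨$⟩ʳ zero)) (permutations-complete (remove zero π))
  where
  insert-cong : ∀ {n} j {σ τ : Permutation′ n} → σ Perm.≈ τ → insert zero j σ Perm.≈ insert zero j τ
  insert-cong j {σ} {τ} σ≈τ zero    = ≡.refl
  insert-cong j {σ} {τ} σ≈τ (suc k) = ≡.cong (punchIn j) (σ≈τ k)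

module Weights {ℓ} (R : RealNumbers ℓ) where

  open RealArithmetic R public
  open LinearAlgebra R public

  private variable n : ℕ

  -- Proofs of x ≢ y are definitionally equal, so a weight is a function of the
  -- pair (x , y) only.
  Weight : ℕ → Set ℓ
  Weight n = (x y : Fin n) → x ≢ y → ℝ

  infix 4 _≐_ _≐?_

  _≐_ : Rel (Weight n) ℓ
  w ≐ u = ∀ x y x≢y → w x y x≢y ≈ u x y x≢y

  𝟘 : Weight n
  𝟘 _ _ _ = 0#

  _≐?_ : Decidable (_≐_ {n})
  w ≐? u = all? λ x → all? λ y → dec x y
    where
    dec : ∀ x y → Dec (∀ x≢y → w x y x≢y ≈ u x y x≢y)
    dec x y with x ≟ᶠ y
    ... | yes x≡y = yes λ x≢y → ⊥-elim (x≢y x≡y)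
    ... | no  x≢y with w x y x≢y ≟ u x y x≢y
    ...   | yes eq = yes λ _ → eq
    ...   | no neq = no λ eq → neq (eq x≢y)

  -- Extension by zero to the diagonal, so that a sum over the y ≠ x is a sum
  -- over all y.
  extend : Weight n → Fin n → Fin n → ℝ
  extend w x y with x ≟ᶠ y
  ... | yes _   = 0#
  ... | no  x≢y = w x y x≢y

  total : Weight n → ℝ
  total {n} w = ∑[ x < n ] ∑[ y < n ] extend w x y

  ⟨_,_⟩ : Weight n → Weight n → ℝ
  ⟨ w , u ⟩ = total λ x y x≢y → w x y x≢y * u x y x≢y

  Centered : Weight n → Set ℓ
  Centered w = total w ≈ 0#

  density : Weight n → ℝ
  density {n} w = total w / (⌜ n ⌝ * (⌜ n ⌝ - ⌜ 1 ⌝))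

  relabel : Permutation′ n → Weight n → Weight n
  relabel π w x y x≢y = w (π ⟨$⟩ˡ x) (π ⟨$⟩ˡ y) (x≢y ∘ injective)
    where
    injective : π ⟨$⟩ˡ x ≡ π ⟨$⟩ˡ y → x ≡ y
    injective eq = ≡.trans (≡.sym (inverseʳ π)) (≡.trans (≡.cong (π ⟨$⟩ʳ_) eq) (inverseʳ π))

  -- Extrema over the symmetric group; the first argument of Extrema.max and
  -- Extrema.min, needed because a list may be empty, is here one of the values.
  maxₚ minₚ : (Permutation′ n → ℝ) → ℝ
  maxₚ {n} f = Extrema.max totalOrder (f Perm.id) (List.map f (permutations n))
  minₚ {n} f = Extrema.min totalOrder (f Perm.id) (List.map f (permutations n))

  disc⁺ disc⁻ disc : Weight n → Weight n → ℝ
  disc⁺ {n} w u = maxₚ (λ π → ⟨ relabel π w , u ⟩) - density w * density u * ⌜ n ⌝ * (⌜ n ⌝ - ⌜ 1 ⌝)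
  disc⁻ {n} w u = density w * density u * ⌜ n ⌝ * (⌜ n ⌝ - ⌜ 1 ⌝) - minₚ (λ π → ⟨ relabel π w , u ⟩)
  disc w u = disc⁺ w u ⊔ᵣ disc⁻ w u

  PairwiseZeroDiscrepant : ∀ {p} → Pred (Weight n) p → Set _
  PairwiseZeroDiscrepant F = ∀ {w u} → w ∈ F → u ∈ F → ¬ (w ≐ u) → disc w u ≈ 0#

  r c p q : Weight n → Vector ℝ n
  r {n} w x = ∑[ y < n ] extend w x y
  c {n} w x = ∑[ y < n ] extend w y x
  p {n} w x = (r w x + c w x) / (⌜ 2 ⌝ * (⌜ n ⌝ - ⌜ 2 ⌝))
  q {n} w x = (r w x - c w x) / (⌜ 2 ⌝ * ⌜ n ⌝)

  infix 9 _ᵀ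
  _ᵀ : Weight n → Weight n
  (f ᵀ) x y x≢y = f y x (≢-sym x≢y)

  g⁺ g⁻ h h⁺ h⁻ : Weight n → Weight n
  g⁺ w x y _   = p w x + p w y
  g⁻ w x y _   = q w x - q w y
  h  w x y x≢y = w x y x≢y - g⁺ w x y x≢y - g⁻ w x y x≢y
  h⁺ w x y x≢y = (h w x y x≢y + (h w ᵀ) x y x≢y) / ⌜ 2 ⌝
  h⁻ w x y x≢y = (h w x y x≢y - (h w ᵀ) x y x≢y) / ⌜ 2 ⌝

  α β : Weight n → Vector ℝ n
  α {n} w x = √ (⌜ 2 ⌝ * (⌜ n ⌝ - ⌜ 2 ⌝)) * p w x
  β {n} w x = √ (⌜ 2 ⌝ * ⌜ n ⌝) * q w x

  Γ : Weight n → Matrix 2 2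
  Γ w 0F 0F = dot (α w) (α w)
  Γ w 0F 1F = dot (α w) (β w)
  Γ w 1F 0F = dot (α w) (β w)
  Γ w 1F 1F = dot (β w) (β w)

  𝟙 : ∀ {p} {P : Set p} → Dec P → ℕ
  𝟙 (yes _) = 1
  𝟙 (no  _) = 0

{-# OPTIONS --safe #-}

-- For centered w and u, disc(w,u) = 0 says that ⟨w_π,u⟩ = 0 for all π. Writing
-- w_xy = a_x + b_y + h_w(x,y), where h_w has zero row and column sums,
--   ⟨w_π,u⟩ = Σ_x M(π⁻¹x,x) + ⟨(h_w)_π,h_u⟩,   M(x,y) = α_w(x) α_u(y) + β_w(x) β_u(y),
-- while tr(Γ_w Γ_u) = Σ_xy M(x,y)², which gives sufficiency. For necessity, the
-- operator (1 - (0 1))(1 - (2 3)) kills the functions of one variable; it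
-- shows that a mixed difference of h_w^± times any mixed difference of h_u^±
-- vanishes. A residual all of whose mixed differences vanish is zero, because
-- its row and column sums are. What remains is Σ_x M(πx,x) = 0 for all π, and as M has zero
-- row and column sums, this forces M = 0.
-- In a pairwise zero-discrepant family the column spaces of the Γ_w are pairwise
-- orthogonal in ℝ², so the ranks add up to at most 2.
module Submission where

open import Defs
open import Algebra.Bundles using (CommutativeRing)
open import Algebra.Solver.Ring.AlmostCommutativeRing
  using (fromCommutativeRing; _-Raw-AlmostCommutative⟶_)
open import Data.Empty using (⊥-elim)
open import Data.Fin.Base using (Fin; zero; suc; splitAt; join; punchOut; _↑ˡ_; _↑ʳ_)
open import Data.Fin.Patterns using (0F; 1F; 2F; 3F)
open import Data.Fin.Permutation as Perm
  using (Permutation′; _⟨$⟩ʳ_; _⟨$⟩ˡ_; _∘ₚ_; inverseˡ; inverseʳ)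
open import Data.Fin.Properties
  using (punchIn-injective; punchIn-punchOut; punchInᵢ≢i; join-splitAt) renaming (_≟_ to _≟ᶠ_)
open import Data.Integer.Base as ℤ using (ℤ; +_; -[1+_])
open import Data.List.Base as List using (List; length; map)
open import Data.List.Relation.Unary.All as All using (All)
open import Data.List.Relation.Unary.AllPairs as AllPairs using (AllPairs)
open import Data.Maybe.Base using (Maybe; just; nothing)
open import Data.Nat as ℕ using (ℕ; zero; suc; z≤n; s≤s)
open import Data.Product using (∃; _×_; _,_; proj₁; proj₂)
open import Data.Sum as Sum using (_⊎_; inj₁; inj₂)
open import Data.Vec.Functional using (Vector; removeAt; _++_; []; _∷_)
open import Data.Vec.Functional.Properties using (lookup-++ˡ; lookup-++ʳ)
open import Function.Base using (_∘_; flip)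
open import Function.Bundles using (_⇔_; mk⇔; Equivalence; Injection)
open import Function.Properties.Inverse using (↔⇒↣)
open import Level using (Level)
open import Relation.Binary.PropositionalEquality as ≡ using (_≡_; _≢_; ≢-sym)
open import Relation.Binary.Structures using (IsDecTotalOrder)
open import Relation.Nullary using (¬_; ¬?; Dec; yes; no)
open import Relation.Nullary.Decidable using (decidable-stable)
open import Relation.Unary using (Pred; _∈_)

import Algebra.Construct.NaturalChoice.Max
import Algebra.Properties.CommutativeSemigroup
import Algebra.Properties.Monoid.Mult
import Algebra.Properties.Ring
import Algebra.Properties.Semiring.Mult
import Algebra.Properties.Semiring.Sum
import Algebra.Solver.Ring
import Data.Integer.Properties as ℤ
import Data.List.Extrema
import Data.List.Relation.Unary.All.Properties as All
import Data.Nat.ListAction as ℕ using (sum)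
import Data.Nat.Properties as ℕ
import Relation.Binary.Reasoning.Setoid

-- Orthogonality under all relabellings passes to linear combinations of relabellings of `w`, so
-- `(1 - (0 1))(1 - (2 3))` may be applied to `w` alone. As `w` and `u` can moreover be relabelled
-- independently, the resulting vanishing product concerns every mixed difference of `w` against
-- every one of `u`: a single nonzero one on one side kills all of them on the other, which is the
-- "or" in conditions (i) and (ii). The missing diagonal shapes the rest. Mixed differences relate
-- distinct points only, so a zero residual cannot be read off at once from its row and column sums.
-- Summing the four-point identity over one point and then over another gives
-- `(n(n-3)+1) S(a,c) + S(c,a) = 0`, that is, a factor `(n-1)(n-2)` on symmetric and `n(n-3)` on
-- antisymmetric residuals; both are nonzero for `n ≥ 4`, the second one not for `n = 3`. The same
-- missing diagonal explains the denominators `2(n-2)` and `2n` of `p` and `q`: with them the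
-- residual has zero line sums. They return as the coefficients of `p p′` and `q q′` in the pairing,
-- whence the square roots in `α` and `β`.

-- The stdlib ring solver with integer coefficients, so that the equality of
-- coefficients is decidable; con (+ k) denotes the numeral k of Defs.
module ℤ-Solver {a b : Level} (R : CommutativeRing a b) where
  open CommutativeRing R
  open Algebra.Properties.Ring ring
  open Algebra.Properties.Semiring.Mult semiring renaming (_×_ to infixr 8 _·_)
  open Relation.Binary.Reasoning.Setoid setoid

  private
    ⟦_⟧ : ℤ → Carrier
    ⟦ + n ⟧      = n · 1#
    ⟦ -[1+ n ] ⟧ = - (suc n · 1#)

    -homo : ∀ i → ⟦ ℤ.- i ⟧ ≈ - ⟦ i ⟧
    -homo (+ zero)   = sym -0#≈0#
    -homo (+ suc n)  = refl
    -homo (-[1+ n ]) = sym (-‿involutive _)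

    ⊖-homo : ∀ m n → ⟦ m ℤ.⊖ n ⟧ ≈ m · 1# - n · 1#
    ⊖-homo zero    zero    = sym (-‿inverseʳ 0#)
    ⊖-homo zero    (suc n) = sym (+-identityˡ _)
    ⊖-homo (suc m) zero    = sym (trans (+-congˡ -0#≈0#) (+-identityʳ _))
    ⊖-homo (suc m) (suc n) = begin
      ⟦ suc m ℤ.⊖ suc n ⟧              ≡⟨ ≡.cong ⟦_⟧ (ℤ.[1+m]⊖[1+n]≡m⊖n m n) ⟩
      ⟦ m ℤ.⊖ n ⟧                      ≈⟨ ⊖-homo m n ⟩
      -- `1# - 1#` is inserted to restore the two successors that the recursion has cancelled.
      m · 1# - n · 1#                  ≈⟨ +-congʳ (+-identityʳ _) ⟨
      m · 1# + 0# - n · 1#             ≈⟨ +-congʳ (+-congˡ (-‿inverseʳ 1#)) ⟨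
      m · 1# + (1# - 1#) - n · 1#      ≈⟨ +-congʳ (+-assoc _ _ _) ⟨
      m · 1# + 1# - 1# - n · 1#        ≈⟨ +-congʳ (+-congʳ (+-comm _ _)) ⟩
      1# + m · 1# - 1# - n · 1#        ≈⟨ +-assoc _ _ _ ⟩
      1# + m · 1# + (- 1# - n · 1#)    ≈⟨ +-congˡ (-‿+-comm 1# (n · 1#)) ⟩
      suc m · 1# - suc n · 1#          ∎

    +-homo : ∀ i j → ⟦ i ℤ.+ j ⟧ ≈ ⟦ i ⟧ + ⟦ j ⟧
    +-homo (+ m)      (+ n)      = ×-homo-+ 1# m n
    +-homo (+ m)      (-[1+ n ]) = ⊖-homo m (suc n)
    +-homo (-[1+ m ]) (+ n)      = trans (⊖-homo n (suc m)) (+-comm _ _)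
    +-homo (-[1+ m ]) (-[1+ n ]) = begin
      - (suc (suc (m ℕ.+ n)) · 1#)        ≡⟨ ≡.cong (λ k → - (k · 1#)) (≡.sym (ℕ.+-suc (suc m) n)) ⟩
      - ((suc m ℕ.+ suc n) · 1#)          ≈⟨ -‿cong (×-homo-+ 1# (suc m) (suc n)) ⟩
      - (suc m · 1# + suc n · 1#)         ≈⟨ -‿+-comm _ _ ⟨
      - (suc m · 1#) - (suc n · 1#)       ∎

    *-homo-pos : ∀ i n → ⟦ i ℤ.* + n ⟧ ≈ ⟦ i ⟧ * ⟦ + n ⟧
    *-homo-pos (+ m)      n = trans (reflexive (≡.cong ⟦_⟧ (≡.sym (ℤ.pos-* m n)))) (×1-homo-* m n)
    *-homo-pos (-[1+ m ]) n = begin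
      ⟦ -[1+ m ] ℤ.* + n ⟧           ≡⟨ ≡.cong ⟦_⟧ (ℤ.neg-distribˡ-* (+ suc m) (+ n)) ⟨
      ⟦ ℤ.- (+ suc m ℤ.* + n) ⟧      ≈⟨ -homo (+ suc m ℤ.* + n) ⟩
      - ⟦ + suc m ℤ.* + n ⟧          ≈⟨ -‿cong (*-homo-pos (+ suc m) n) ⟩
      - (suc m · 1# * (n · 1#))      ≈⟨ -‿distribˡ-* _ _ ⟩
      - (suc m · 1#) * (n · 1#)      ∎

    *-homo : ∀ i j → ⟦ i ℤ.* j ⟧ ≈ ⟦ i ⟧ * ⟦ j ⟧
    *-homo i (+ n)      = *-homo-pos i n
    *-homo i (-[1+ n ]) = begin
      ⟦ i ℤ.* -[1+ n ] ⟧             ≡⟨ ≡.cong ⟦_⟧ (ℤ.neg-distribʳ-* i (+ suc n)) ⟨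
      ⟦ ℤ.- (i ℤ.* + suc n) ⟧        ≈⟨ -homo (i ℤ.* + suc n) ⟩
      - ⟦ i ℤ.* + suc n ⟧            ≈⟨ -‿cong (*-homo-pos i (suc n)) ⟩
      - (⟦ i ⟧ * (suc n · 1#))       ≈⟨ -‿distribʳ-* _ _ ⟩
      ⟦ i ⟧ * - (suc n · 1#)         ∎

    homomorphism : ℤ.+-*-rawRing -Raw-AlmostCommutative⟶ fromCommutativeRing R
    homomorphism = record
      { ⟦_⟧ = ⟦_⟧ ; +-homo = +-homo ; *-homo = *-homo ; -‿homo = -homo
      ; 0-homo = refl ; 1-homo = +-identityʳ 1# }

    _≟ᶻ_ : ∀ i j → Maybe (⟦ i ⟧ ≈ ⟦ j ⟧)
    i ≟ᶻ j with i ℤ.≟ j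
    ... | yes i≡j = just (reflexive (≡.cong ⟦_⟧ i≡j))
    ... | no  _   = nothing

  open Algebra.Solver.Ring _ _ homomorphism _≟ᶻ_ public

-- Arithmetic in the ordered field of real numbers

module OrderedField {ℓ : Level} (R : RealNumbers ℓ) where
  open RealArithmetic R
  open CommutativeRing commutativeRing public
    using (refl; sym; trans; reflexive; +-cong; +-congˡ; +-congʳ; *-cong; *-congˡ; *-congʳ;
           -‿cong; +-comm; +-assoc; *-comm; +-identityˡ; +-identityʳ; *-identityˡ;
           *-identityʳ; zeroˡ; zeroʳ; distribˡ; distribʳ; -‿inverseˡ; -‿inverseʳ)
  open CommutativeRing commutativeRing using (+-monoid)
  open Algebra.Properties.Ring ring public
    using (-0#≈0#; -1*x≈-x; x∙y⁻¹≈ε⇒x≈y; -‿involutive; -‿+-comm; -‿distribˡ-*)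
  open IsDecTotalOrder isDecTotalOrder public using (≤-respˡ-≈; ≤-respʳ-≈; antisym)
    renaming (refl to ≤-refl; reflexive to ≤-reflexive; trans to ≤-trans; total to ≤-total)
  open ℤ-Solver commutativeRing public using (solve; _:=_; _:+_; _:*_; _:-_; :-_; con)
  open Relation.Binary.Reasoning.Setoid setoid

  -- Equality of reals is decidable, so equations may be proved by contradiction.
  stable : ∀ {x y} → ¬ ¬ (x ≈ y) → x ≈ y
  stable {x} {y} = decidable-stable (x ≟ y)

  *-cancel-0 : ∀ {x y} → ¬ (x ≈ 0#) → x * y ≈ 0# → y ≈ 0#
  *-cancel-0 {x} {y} x≉0 xy≈0 = begin
    y                 ≈⟨ *-identityˡ y ⟨
    1# * y            ≈⟨ *-congʳ (*-inverseʳ x≉0) ⟨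
    x * x ⁻¹ * y      ≈⟨ solve 3 (λ x i y → x :* i :* y := x :* y :* i) refl x (x ⁻¹) y ⟩
    x * y * x ⁻¹      ≈⟨ *-congʳ xy≈0 ⟩
    0# * x ⁻¹         ≈⟨ zeroˡ _ ⟩
    0#                ∎

  *≉0 : ∀ {x y} → ¬ (x ≈ 0#) → ¬ (y ≈ 0#) → ¬ (x * y ≈ 0#)
  *≉0 x≉0 y≉0 xy≈0 = y≉0 (*-cancel-0 x≉0 xy≈0)

  x*[y/x]≈y : ∀ {x} y → ¬ (x ≈ 0#) → x * (y / x) ≈ y
  x*[y/x]≈y {x} y x≉0 = begin
    x * (y * x ⁻¹)  ≈⟨ solve 3 (λ x y i → x :* (y :* i) := y :* (x :* i)) refl x y (x ⁻¹) ⟩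
    y * (x * x ⁻¹)  ≈⟨ *-congˡ (*-inverseʳ x≉0) ⟩
    y * 1#          ≈⟨ *-identityʳ y ⟩
    y               ∎

  +-nonNeg : ∀ {x y} → 0# ≤ x → 0# ≤ y → 0# ≤ x + y
  +-nonNeg {x} 0≤x 0≤y = ≤-trans 0≤x (≤-respˡ-≈ (+-identityʳ x) (+-monoʳ-≤ x 0≤y))

  x≤0⇒0≤-x : ∀ {x} → x ≤ 0# → 0# ≤ - x
  x≤0⇒0≤-x {x} x≤0 = ≤-respˡ-≈ (-‿inverseˡ x) (≤-respʳ-≈ (+-identityʳ (- x)) (+-monoʳ-≤ (- x) x≤0))

  -x≤0⇒0≤x : ∀ {x} → - x ≤ 0# → 0# ≤ x
  -x≤0⇒0≤x {x} -x≤0 = ≤-respʳ-≈ (-‿involutive x) (x≤0⇒0≤-x -x≤0)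

  square-nonNeg : ∀ x → 0# ≤ x * x
  square-nonNeg x with ≤-total 0# x
  ... | inj₁ 0≤x = *-nonNeg 0≤x 0≤x
  ... | inj₂ x≤0 = ≤-respʳ-≈ (solve 1 (λ x → :- x :* :- x := x :* x) refl x)
                             (*-nonNeg (x≤0⇒0≤-x x≤0) (x≤0⇒0≤-x x≤0))

  square≈0⇒≈0 : ∀ {x} → x * x ≈ 0# → x ≈ 0#
  square≈0⇒≈0 {x} xx≈0 = stable λ x≉0 → x≉0 (*-cancel-0 x≉0 xx≈0)

  nonNeg-sum≈0ˡ : ∀ {x y} → 0# ≤ x → 0# ≤ y → x + y ≈ 0# → x ≈ 0#
  nonNeg-sum≈0ˡ {x} 0≤x 0≤y x+y≈0 =
    antisym (≤-respˡ-≈ (+-identityʳ x) (≤-respʳ-≈ x+y≈0 (+-monoʳ-≤ x 0≤y))) 0≤x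

  nonNeg-sum≈0ʳ : ∀ {x y} → 0# ≤ x → 0# ≤ y → x + y ≈ 0# → y ≈ 0#
  nonNeg-sum≈0ʳ 0≤x 0≤y x+y≈0 = nonNeg-sum≈0ˡ 0≤y 0≤x (trans (+-comm _ _) x+y≈0)

  0≤1 : 0# ≤ 1#
  0≤1 = ≤-respʳ-≈ (*-identityˡ 1#) (square-nonNeg 1#)

  ⌜⌝-nonNeg : ∀ n → 0# ≤ ⌜ n ⌝
  ⌜⌝-nonNeg zero    = ≤-refl
  ⌜⌝-nonNeg (suc n) = +-nonNeg 0≤1 (⌜⌝-nonNeg n)

  ⌜⌝-+ : ∀ m n → ⌜ m ℕ.+ n ⌝ ≈ ⌜ m ⌝ + ⌜ n ⌝
  ⌜⌝-+ = Algebra.Properties.Monoid.Mult.×-homo-+ +-monoid 1#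

  ⌜m+n⌝-⌜m⌝≈⌜n⌝ : ∀ m n → ⌜ m ℕ.+ n ⌝ - ⌜ m ⌝ ≈ ⌜ n ⌝
  ⌜m+n⌝-⌜m⌝≈⌜n⌝ m n = trans (+-congʳ (⌜⌝-+ m n))
    (solve 2 (λ x y → x :+ y :- x := y) refl ⌜ m ⌝ ⌜ n ⌝)

  ⌜suc⌝≉0 : ∀ n → ¬ (⌜ suc n ⌝ ≈ 0#)
  ⌜suc⌝≉0 n eq = 1≉0 (nonNeg-sum≈0ˡ 0≤1 (⌜⌝-nonNeg n) eq)

  x≈-x⇒x≈0 : ∀ {x} → x ≈ - x → x ≈ 0#
  x≈-x⇒x≈0 {x} x≈-x = *-cancel-0 (⌜suc⌝≉0 1) (begin
    ⌜ 2 ⌝ * x   ≈⟨ solve 1 (λ x → con (+ 2) :* x := x :+ x) refl x ⟩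
    x + x       ≈⟨ +-congˡ x≈-x ⟩
    x - x       ≈⟨ -‿inverseʳ x ⟩
    0#          ∎)

  √≉0 : ∀ {x} → 0# ≤ x → ¬ (x ≈ 0#) → ¬ (√ x ≈ 0#)
  √≉0 0≤x x≉0 √x≈0 = x≉0 (trans (sym (√-square 0≤x)) (trans (*-congʳ √x≈0) (zeroˡ _)))

-- Finite sums

module Sums {ℓ : Level} (R : RealNumbers ℓ) where
  open RealArithmetic R
  open OrderedField R
  open Algebra.Properties.Semiring.Sum semiring public
    using (∑-distrib-+; ∑-comm; sum-permute; *-distribˡ-sum; *-distribʳ-sum; sum-cong-≋)
  open Algebra.Properties.Semiring.Sum semiring using (sum-remove; sum-replicate-zero)
  open Relation.Binary.Reasoning.Setoid setoid

  private variable n m : ℕ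

  sum≈0 : (f : Vector ℝ n) → (∀ x → f x ≈ 0#) → sum f ≈ 0#
  sum≈0 {n} f f≈0 = trans (sum-cong-≋ f≈0) (sum-replicate-zero n)

  sum-const : ∀ n (x : ℝ) → sum {n} (λ _ → x) ≈ ⌜ n ⌝ * x
  sum-const zero    x = sym (zeroˡ x)
  sum-const (suc n) x = begin
    x + sum {n} (λ _ → x)  ≈⟨ +-congˡ (sum-const n x) ⟩
    x + ⌜ n ⌝ * x          ≈⟨ +-congʳ (*-identityˡ x) ⟨
    1# * x + ⌜ n ⌝ * x     ≈⟨ distribʳ x 1# ⌜ n ⌝ ⟨
    ⌜ suc n ⌝ * x          ∎

  sum-neg : (f : Vector ℝ n) → sum (λ x → - f x) ≈ - sum f
  sum-neg {zero}  f = sym -0#≈0#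
  sum-neg {suc n} f = trans (+-congˡ (sum-neg (f ∘ suc))) (-‿+-comm _ _)

  sum-minus : (f g : Vector ℝ n) → sum (λ x → f x - g x) ≈ sum f - sum g
  sum-minus f g = trans (∑-distrib-+ f (λ x → - g x)) (+-congˡ (sum-neg g))

  sum-*ˡ : ∀ c (f : Vector ℝ n) → sum (λ x → c * f x) ≈ c * sum f
  sum-*ˡ c f = sym (*-distribˡ-sum c f)

  sum-*ʳ : ∀ c (f : Vector ℝ n) → sum (λ x → f x * c) ≈ sum f * c
  sum-*ʳ c f = sym (*-distribʳ-sum c f)

  sum*sum : (f : Vector ℝ n) (g : Vector ℝ m) → sum f * sum g ≈ ∑[ x < n ] ∑[ y < m ] (f x * g y)
  sum*sum f g = trans (*-distribʳ-sum (sum g) f) (sum-cong-≋ λ x → *-distribˡ-sum (f x) g)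

  sum-supported₁ : (f : Vector ℝ n) (a : Fin n) → (∀ x → x ≢ a → f x ≈ 0#) → sum f ≈ f a
  sum-supported₁ {suc n} f a f≈0 = begin
    sum f                      ≈⟨ sum-remove {i = a} f ⟩
    f a + sum (removeAt f a)   ≈⟨ +-congˡ (sum≈0 (removeAt f a) λ j → f≈0 _ (punchInᵢ≢i a j)) ⟩
    f a + 0#                   ≈⟨ +-identityʳ _ ⟩
    f a                        ∎

  sum-supported₂ : (f : Vector ℝ n) (a b : Fin n) → a ≢ b →
                   (∀ x → x ≢ a → x ≢ b → f x ≈ 0#) → sum f ≈ f a + f b
  sum-supported₂ {suc n} f a b a≢b f≈0 = begin
    sum f                          ≈⟨ sum-remove {i = a} f ⟩
    f a + sum (removeAt f a)       ≈⟨ +-congˡ (sum-supported₁ (removeAt f a) (punchOut a≢b) rest≈0) ⟩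
    f a + removeAt f a (punchOut a≢b) ≡⟨ ≡.cong (λ x → f a + f x) (punchIn-punchOut a≢b) ⟩
    f a + f b                      ∎
    where
    rest≈0 : ∀ j → j ≢ punchOut a≢b → removeAt f a j ≈ 0#
    rest≈0 j j≢ = f≈0 _ (punchInᵢ≢i a j) λ eq →
      j≢ (punchIn-injective a j (punchOut a≢b) (≡.trans eq (≡.sym (punchIn-punchOut a≢b))))

  sum-nonNeg : (f : Vector ℝ n) → (∀ x → 0# ≤ f x) → 0# ≤ sum f
  sum-nonNeg {zero}  f 0≤f = ≤-refl
  sum-nonNeg {suc n} f 0≤f = +-nonNeg (0≤f zero) (sum-nonNeg (f ∘ suc) (0≤f ∘ suc))

  nonNeg-sum≈0 : (f : Vector ℝ n) → (∀ x → 0# ≤ f x) → sum f ≈ 0# → ∀ x → f x ≈ 0#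
  nonNeg-sum≈0 {suc n} f 0≤f eq zero    = nonNeg-sum≈0ˡ (0≤f zero) (sum-nonNeg _ (0≤f ∘ suc)) eq
  nonNeg-sum≈0 {suc n} f 0≤f eq (suc x) =
    nonNeg-sum≈0 (f ∘ suc) (0≤f ∘ suc) (nonNeg-sum≈0ʳ (0≤f zero) (sum-nonNeg _ (0≤f ∘ suc)) eq) x

  sum-+ : ∀ k {m} (f : Vector ℝ (k ℕ.+ m)) → sum f ≈ sum (λ i → f (i ↑ˡ m)) + sum (λ j → f (k ↑ʳ j))
  sum-+ zero    f = sym (+-identityˡ _)
  sum-+ (suc k) f = trans (+-congˡ (sum-+ k (f ∘ suc))) (sym (+-assoc _ _ _))

-- Permutations with prescribed values

module Realisation where
  private variable n m : ℕ

  transpose-left : (i j : Fin n) → Perm.transpose i j ⟨$⟩ʳ i ≡ j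
  transpose-left i j with i ≟ᶠ i
  ... | yes _   = ≡.refl
  ... | no  i≢i = ⊥-elim (i≢i ≡.refl)

  transpose-right : (i j : Fin n) → Perm.transpose i j ⟨$⟩ʳ j ≡ i
  transpose-right i j with j ≟ᶠ i
  ... | yes j≡i = j≡i
  ... | no  _ with j ≟ᶠ j
  ...   | yes _   = ≡.refl
  ...   | no  j≢j = ⊥-elim (j≢j ≡.refl)

  transpose-other : {i j k : Fin n} → k ≢ i → k ≢ j → Perm.transpose i j ⟨$⟩ʳ k ≡ k
  transpose-other {i = i} {j} {k} k≢i k≢j with k ≟ᶠ i
  ... | yes k≡i = ⊥-elim (k≢i k≡i)
  ... | no  _ with k ≟ᶠ j
  ...   | yes k≡j = ⊥-elim (k≢j k≡j)
  ...   | no  _   = ≡.refl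

  redirect : (π : Permutation′ n) (i a : Fin n) →
             ∃ λ (ρ : Permutation′ n) → ρ ⟨$⟩ʳ i ≡ a × (∀ {j b} → j ≢ i → π ⟨$⟩ʳ j ≡ b → b ≢ a → ρ ⟨$⟩ʳ j ≡ b)
  redirect π i a = Perm.transpose i (π ⟨$⟩ˡ a) ∘ₚ π ,
    ≡.trans (≡.cong (π ⟨$⟩ʳ_) (transpose-left i (π ⟨$⟩ˡ a))) (inverseʳ π) ,
    λ { j≢i ≡.refl πj≢a → ≡.cong (π ⟨$⟩ʳ_)
          (transpose-other j≢i λ j≡ → πj≢a (≡.trans (≡.cong (π ⟨$⟩ʳ_) j≡) (inverseʳ π))) }

  realise₂ : {i j a b : Fin n} → i ≢ j → a ≢ b →
             ∃ λ (π : Permutation′ n) → π ⟨$⟩ʳ i ≡ a × π ⟨$⟩ʳ j ≡ b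
  realise₂ {i = i} {j} {a} {b} i≢j a≢b with redirect Perm.id i a
  ... | ρ , ρi , _ with redirect ρ j b
  ...   | σ , σj , keep = σ , keep i≢j ρi a≢b , σj

  realise₄ : {a b c d : Fin (4 ℕ.+ m)} → a ≢ b → a ≢ c → a ≢ d → b ≢ c → b ≢ d → c ≢ d →
             ∃ λ (π : Permutation′ (4 ℕ.+ m)) →
               π ⟨$⟩ʳ 0F ≡ a × π ⟨$⟩ʳ 1F ≡ b × π ⟨$⟩ʳ 2F ≡ c × π ⟨$⟩ʳ 3F ≡ d
  realise₄ {c = c} {d} a≢b a≢c a≢d b≢c b≢d c≢d with realise₂ {i = 0F} {1F} (λ ()) a≢b
  ... | ρ , ρ0 , ρ1 with redirect ρ 2F c
  ...   | σ , σ2 , keep with redirect σ 3F d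
  ...     | τ , τ3 , hold =
    τ , hold (λ ()) (keep (λ ()) ρ0 a≢c) a≢d , hold (λ ()) (keep (λ ()) ρ1 b≢c) b≢d
      , hold (λ ()) σ2 c≢d , τ3

-- Full square grids and orthogonality under relabelling

module Grids {ℓ : Level} (R : RealNumbers ℓ) where
  open RealArithmetic R
  open OrderedField R
  open Sums R
  open Relation.Binary.Reasoning.Setoid setoid

  private variable n m : ℕ

  Grid : ℕ → Set ℓ
  Grid n = Fin n → Fin n → ℝ

  inner : Grid n → Grid n → ℝ
  inner {n} A B = ∑[ x < n ] ∑[ y < n ] (A x y * B x y)

  permute : Permutation′ n → Grid n → Grid n
  permute π A x y = A (π ⟨$⟩ʳ x) (π ⟨$⟩ʳ y)

  Orthogonal : Grid n → Grid n → Set ℓ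
  Orthogonal A B = ∀ π → inner (permute π A) B ≈ 0#

  ∑∑-cong : {f g : Fin m → Fin n → ℝ} → (∀ x y → f x y ≈ g x y) →
            ∑[ x < m ] ∑[ y < n ] f x y ≈ ∑[ x < m ] ∑[ y < n ] g x y
  ∑∑-cong f≈g = sum-cong-≋ λ x → sum-cong-≋ (f≈g x)

  ∑∑-distrib-+ : (f g : Fin m → Fin n → ℝ) →
                 ∑[ x < m ] ∑[ y < n ] (f x y + g x y) ≈
                 ∑[ x < m ] ∑[ y < n ] f x y + ∑[ x < m ] ∑[ y < n ] g x y
  ∑∑-distrib-+ f g = trans (sum-cong-≋ λ x → ∑-distrib-+ (f x) (g x)) (∑-distrib-+ (sum ∘ f) (sum ∘ g))

  ∑∑-minus : (f g : Fin m → Fin n → ℝ) →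
             ∑[ x < m ] ∑[ y < n ] (f x y - g x y) ≈
             ∑[ x < m ] ∑[ y < n ] f x y - ∑[ x < m ] ∑[ y < n ] g x y
  ∑∑-minus f g = trans (sum-cong-≋ λ x → sum-minus (f x) (g x)) (sum-minus (sum ∘ f) (sum ∘ g))

  inner-congˡ : {A A′ : Grid n} (B : Grid n) → (∀ x y → A x y ≈ A′ x y) → inner A B ≈ inner A′ B
  inner-congˡ B A≈A′ = ∑∑-cong λ x y → *-congʳ (A≈A′ x y)

  inner-zeroˡ : (A B : Grid n) → (∀ x y → A x y ≈ 0#) → inner A B ≈ 0#
  inner-zeroˡ A B A≈0 = sum≈0 _ λ x → sum≈0 _ λ y → trans (*-congʳ (A≈0 x y)) (zeroˡ (B x y))

  inner-comm : (A B : Grid n) → inner A B ≈ inner B A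
  inner-comm A B = ∑∑-cong λ x y → *-comm (A x y) (B x y)

  inner-minus : (A A′ B : Grid n) → inner (λ x y → A x y - A′ x y) B ≈ inner A B - inner A′ B
  inner-minus A A′ B = trans
    (∑∑-cong λ x y → solve 3 (λ a a′ b → (a :- a′) :* b := a :* b :- a′ :* b) refl (A x y) (A′ x y) (B x y))
    (∑∑-minus (λ x y → A x y * B x y) (λ x y → A′ x y * B x y))

  inner-permute : ∀ π (A B : Grid n) → inner (permute π A) (permute π B) ≈ inner A B
  inner-permute {n} π A B = sym (trans
    (sum-cong-≋ λ x → sum-permute (λ y → A x y * B x y) π)
    (sum-permute (λ x → ∑[ y < n ] (A x (π ⟨$⟩ʳ y) * B x (π ⟨$⟩ʳ y))) π))

  inner-flip : (A B : Grid n) → inner (flip A) (flip B) ≈ inner A B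
  inner-flip A B = ∑-comm (λ x y → A y x * B y x)

  inner-additive : (a b : Vector ℝ n) (B : Grid n) → inner (λ x y → a x + b y) B ≈
                   ∑[ x < n ] (a x * sum (B x)) + ∑[ y < n ] (b y * sum (flip B y))
  inner-additive {n} a b B = begin
    ∑[ x < n ] ∑[ y < n ] ((a x + b y) * B x y)
      ≈⟨ ∑∑-cong (λ x y → distribʳ (B x y) (a x) (b y)) ⟩
    ∑[ x < n ] ∑[ y < n ] (a x * B x y + b y * B x y)
      ≈⟨ ∑∑-distrib-+ (λ x y → a x * B x y) (λ x y → b y * B x y) ⟩
    ∑[ x < n ] ∑[ y < n ] (a x * B x y) + ∑[ x < n ] ∑[ y < n ] (b y * B x y)
      ≈⟨ +-cong (sum-cong-≋ λ x → sum-*ˡ (a x) (B x))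
                (trans (∑-comm (λ x y → b y * B x y)) (sum-cong-≋ λ y → sum-*ˡ (b y) (flip B y))) ⟩
    ∑[ x < n ] (a x * sum (B x)) + ∑[ y < n ] (b y * sum (flip B y)) ∎

  -- The relabellings of `permute ρ A` are among those of `A`, so `1 - ρ` can act on the left
  -- argument alone.
  Orthogonal-minus : ∀ {A B : Grid n} ρ → Orthogonal A B →
                     Orthogonal (λ x y → A x y - permute ρ A x y) B
  Orthogonal-minus {A = A} {B} ρ A⊥B π = begin
    inner (permute π (λ x y → A x y - permute ρ A x y)) B
      ≈⟨ inner-minus (permute π A) (permute (π ∘ₚ ρ) A) B ⟩
    inner (permute π A) B - inner (permute (π ∘ₚ ρ) A) B
      ≈⟨ +-cong (A⊥B π) (-‿cong (A⊥B (π ∘ₚ ρ))) ⟩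
    0# - 0#
      ≈⟨ -‿inverseʳ 0# ⟩
    0# ∎

  -- The change of variables by `σ` in both arguments moves everything onto `A`, where the bound `π`
  -- absorbs it.
  Orthogonal-permute : ∀ {A B : Grid n} ρ σ → Orthogonal A B → Orthogonal (permute ρ A) (permute σ B)
  Orthogonal-permute {A = A} {B} ρ σ A⊥B π = begin
    inner (permute (π ∘ₚ ρ) A) (permute σ B)
      ≈⟨ inner-congˡ (permute σ B) (λ x y → reflexive (≡.cong₂ (permute (π ∘ₚ ρ) A)
           (≡.sym (inverseˡ σ {x})) (≡.sym (inverseˡ σ {y})))) ⟩
    inner (permute σ (permute (Perm.flip σ ∘ₚ π ∘ₚ ρ) A)) (permute σ B)
      ≈⟨ inner-permute σ (permute (Perm.flip σ ∘ₚ π ∘ₚ ρ) A) B ⟩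
    inner (permute (Perm.flip σ ∘ₚ π ∘ₚ ρ) A) B
      ≈⟨ A⊥B (Perm.flip σ ∘ₚ π ∘ₚ ρ) ⟩
    0# ∎

  -- The mixed difference: the entry at `(0 , 2)` of `(1 - (0 1)) (1 - (2 3)) A`. It reads
  -- off-diagonal entries only.
  Δ : Grid (4 ℕ.+ m) → ℝ
  Δ A = A 0F 2F - A 1F 2F - A 0F 3F + A 1F 3F

-- Mixed differences of orthogonal grids

module Quadruples {ℓ : Level} (R : RealNumbers ℓ) where
  open RealArithmetic R
  open OrderedField R
  open Sums R
  open Grids R
  open Relation.Binary.Reasoning.Setoid setoid

  private variable m : ℕ

  private
    sum-first₂ : (f : Vector ℝ (4 ℕ.+ m)) → (∀ k → f (suc (suc k)) ≈ 0#) → sum f ≈ f 0F + f 1F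
    sum-first₂ f f≈0 = +-congˡ (trans (+-congˡ (sum≈0 (λ k → f (suc (suc k))) f≈0)) (+-identityʳ _))

    sum-first₄ : (f : Vector ℝ (4 ℕ.+ m)) → (∀ k → f (suc (suc (suc (suc k)))) ≈ 0#) →
                 sum f ≈ f 0F + (f 1F + (f 2F + f 3F))
    sum-first₄ f f≈0 = +-congˡ (+-congˡ (+-congˡ
      (trans (+-congˡ (sum≈0 (λ k → f (suc (suc (suc (suc k))))) f≈0)) (+-identityʳ _))))

    cancel : ∀ a b → (a - a) - (b - b) ≈ 0#
    cancel = solve 2 (λ a b → (a :- a) :- (b :- b) := con (+ 0)) refl

    last₂ : ∀ {a b c} → a ≈ 0# → b ≈ 0# → a + (b + c) ≈ c
    last₂ a≈0 b≈0 = trans (+-cong a≈0 (trans (+-congʳ b≈0) (+-identityˡ _))) (+-identityˡ _)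

    interchange : ∀ a b c d e f g h → (a + b) + (c + d) + ((e + f) + (g + h)) ≈
                                      (a + b) + ((c + d) + ((e + g) + (f + h)))
    interchange = solve 8 (λ a b c d e f g h → (a :+ b) :+ (c :+ d) :+ ((e :+ f) :+ (g :+ h)) :=
                             (a :+ b) :+ ((c :+ d) :+ ((e :+ g) :+ (f :+ h)))) refl

    vanish : ∀ {k} b → k ≈ 0# → k * b ≈ 0#
    vanish b k≈0 = trans (*-congʳ k≈0) (zeroˡ b)

  -- (1 - (0 1)) (1 - (2 3)) A is supported on the entries joining {0 , 1} to
  -- {2 , 3}, so its product with B has only eight terms.
  Δ-orthogonal : {A B : Grid (4 ℕ.+ m)} → Orthogonal A B →
                 Δ A * Δ B + Δ (flip A) * Δ (flip B) ≈ 0#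
  Δ-orthogonal {m} {A} {B} A⊥B = begin
    Δ A * Δ B + Δ (flip A) * Δ (flip B)
      ≈⟨ +-cong (expand (Δ A) (B 0F 2F) (B 0F 3F) (B 1F 2F) (B 1F 3F))
                (expand (Δ (flip A)) (B 2F 0F) (B 3F 0F) (B 2F 1F) (B 3F 1F)) ⟩
    (Δ A * B 0F 2F + - Δ A * B 0F 3F) + (- Δ A * B 1F 2F + Δ A * B 1F 3F) +
    ((Δ (flip A) * B 2F 0F + - Δ (flip A) * B 3F 0F) + (- Δ (flip A) * B 2F 1F + Δ (flip A) * B 3F 1F))
      ≈⟨ interchange _ _ _ _ _ _ _ _ ⟩
    (Δ A * B 0F 2F + - Δ A * B 0F 3F) + ((- Δ A * B 1F 2F + Δ A * B 1F 3F) +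
    ((Δ (flip A) * B 2F 0F + - Δ (flip A) * B 2F 1F) + (- Δ (flip A) * B 3F 0F + Δ (flip A) * B 3F 1F)))
      ≈⟨ +-cong (+-cong (*-congʳ (plus _ _ _ _)) (*-congʳ (minus₁ _ _ _ _)))
        (+-cong (+-cong (*-congʳ (minus₂ _ _ _ _)) (*-congʳ (plus′ _ _ _ _)))
        (+-cong (+-cong (*-congʳ (plus _ _ _ _)) (*-congʳ (minus₂ _ _ _ _)))
                (+-cong (*-congʳ (minus₁ _ _ _ _)) (*-congʳ (plus′ _ _ _ _))))) ⟩
    (T 0F 2F + T 0F 3F) + ((T 1F 2F + T 1F 3F) + ((T 2F 0F + T 2F 1F) + (T 3F 0F + T 3F 1F)))
      ≈⟨ +-cong row₀ (+-cong row₁ (+-cong row₂ row₃)) ⟨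
    sum (T 0F) + (sum (T 1F) + (sum (T 2F) + sum (T 3F)))
      ≈⟨ sum-first₄ (sum ∘ T) rowₖ ⟨
    inner K B
      ≈⟨ Orthogonal-minus {A = λ x y → A x y - permute τ A x y} {B} σ (Orthogonal-minus {A = A} {B} τ A⊥B) Perm.id ⟩
    0# ∎
    where
    τ σ : Permutation′ (4 ℕ.+ m)
    τ = Perm.transpose 0F 1F
    σ = Perm.transpose 2F 3F

    K T : Grid (4 ℕ.+ m)
    K x y = (A x y - permute τ A x y) - permute σ (λ x y → A x y - permute τ A x y) x y
    T x y = K x y * B x y

    expand : ∀ k a b c d → k * (a - c - b + d) ≈ (k * a + - k * b) + (- k * c + k * d)
    expand = solve 5 (λ k a b c d → k :* (a :- c :- b :+ d) :=
                        (k :* a :+ :- k :* b) :+ (:- k :* c :+ k :* d)) refl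

    plus : ∀ a b c d → a - b - c + d ≈ (a - b) - (c - d)
    plus = solve 4 (λ a b c d → a :- b :- c :+ d := (a :- b) :- (c :- d)) refl
    minus₁ : ∀ a b c d → - (a - b - c + d) ≈ (c - d) - (a - b)
    minus₁ = solve 4 (λ a b c d → :- (a :- b :- c :+ d) := (c :- d) :- (a :- b)) refl
    minus₂ : ∀ a b c d → - (a - b - c + d) ≈ (b - a) - (d - c)
    minus₂ = solve 4 (λ a b c d → :- (a :- b :- c :+ d) := (b :- a) :- (d :- c)) refl
    plus′ : ∀ a b c d → a - b - c + d ≈ (d - c) - (b - a)
    plus′ = solve 4 (λ a b c d → a :- b :- c :+ d := (d :- c) :- (b :- a)) refl

    -- An entry of `K` vanishes as `X - X` when `σ` fixes both indices, and by `cancel` when `τ`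
    -- does. Only pairs with one index in {0 , 1} and the other in {2 , 3} escape both.
    row₀ : sum (T 0F) ≈ T 0F 2F + T 0F 3F
    row₀ = trans (sum-first₄ (T 0F) λ k → vanish _ (-‿inverseʳ _))
      (last₂ (vanish _ (-‿inverseʳ _)) (vanish _ (-‿inverseʳ _)))
    row₁ : sum (T 1F) ≈ T 1F 2F + T 1F 3F
    row₁ = trans (sum-first₄ (T 1F) λ k → vanish _ (-‿inverseʳ _))
      (last₂ (vanish _ (-‿inverseʳ _)) (vanish _ (-‿inverseʳ _)))
    row₂ : sum (T 2F) ≈ T 2F 0F + T 2F 1F
    row₂ = sum-first₂ (T 2F) λ
      { 0F → vanish _ (cancel _ _) ; 1F → vanish _ (cancel _ _) ; (suc (suc k)) → vanish _ (cancel _ _) }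
    row₃ : sum (T 3F) ≈ T 3F 0F + T 3F 1F
    row₃ = sum-first₂ (T 3F) λ
      { 0F → vanish _ (cancel _ _) ; 1F → vanish _ (cancel _ _) ; (suc (suc k)) → vanish _ (cancel _ _) }
    rowₖ : ∀ k → sum (T (suc (suc (suc (suc k))))) ≈ 0#
    rowₖ k = sum≈0 (T (suc (suc (suc (suc k))))) λ
      { 0F → vanish _ (-‿inverseʳ _) ; 1F → vanish _ (-‿inverseʳ _)
      ; 2F → vanish _ (cancel _ _) ; 3F → vanish _ (cancel _ _)
      ; (suc (suc (suc (suc _)))) → vanish _ (-‿inverseʳ _) }

-- Vanishing criteria for grids with zero line sums

module Vanishing {ℓ : Level} (R : RealNumbers ℓ) where
  open RealArithmetic R
  open OrderedField R
  open Sums R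
  open Grids R
  open Quadruples R
  open Realisation
  open Relation.Binary.Reasoning.Setoid setoid

  private variable n m : ℕ


  -- Twice the symmetric part of `A` for `s = 1` and twice the antisymmetric part for `s = -1`; the
  -- parameter lets one argument serve both.
  twist : ℝ → Grid n → Grid n
  twist s A x y = A x y + s * A y x

  Δ-twist : ∀ s (A : Grid (4 ℕ.+ m)) → Δ (twist s A) ≈ Δ A + s * Δ (flip A)
  Δ-twist s A = lemma s (A 0F 2F) (A 1F 2F) (A 0F 3F) (A 1F 3F) (A 2F 0F) (A 2F 1F) (A 3F 0F) (A 3F 1F)
    where
    lemma : ∀ s a b c d a′ b′ c′ d′ → (a + s * a′) - (b + s * b′) - (c + s * c′) + (d + s * d′) ≈
            a - b - c + d + s * (a′ - b′ - c′ + d′)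
    lemma = solve 9 (λ s a b c d a′ b′ c′ d′ →
      (a :+ s :* a′) :- (b :+ s :* b′) :- (c :+ s :* c′) :+ (d :+ s :* d′) :=
      a :- b :- c :+ d :+ s :* (a′ :- b′ :- c′ :+ d′)) refl

  -- Exchanging {0 , 1} with {2 , 3} in A turns Δ-orthogonal into a second
  -- relation, which decouples the symmetric part from the antisymmetric one.
  Δ-twist-orthogonal : ∀ s {A B : Grid (4 ℕ.+ m)} → s * s ≈ 1# → Orthogonal A B →
                       Δ (twist s A) * Δ (twist s B) ≈ 0#
  Δ-twist-orthogonal s {A} {B} ss≈1 A⊥B = begin
    Δ (twist s A) * Δ (twist s B)
      ≈⟨ *-cong (Δ-twist s A) (Δ-twist s B) ⟩
    (a + s * a′) * (b + s * b′)
      ≈⟨ solve 5 (λ s a a′ b b′ → (a :+ s :* a′) :* (b :+ s :* b′) :=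
           (a :* b :+ s :* s :* (a′ :* b′)) :+ s :* (a′ :* b :+ a :* b′)) refl s a a′ b b′ ⟩
    (a * b + s * s * (a′ * b′)) + s * (a′ * b + a * b′)
      ≈⟨ +-cong (+-congˡ (trans (*-congʳ ss≈1) (*-identityˡ _)))
                (*-congˡ (sym (+-cong (*-congʳ swapped) (*-congʳ swappedᵀ)))) ⟩
    (a * b + a′ * b′) + s * (Δ (permute ρ A) * b + Δ (flip (permute ρ A)) * b′)
      ≈⟨ +-cong (Δ-orthogonal {A = A} {B} A⊥B)
           (*-congˡ (Δ-orthogonal {A = permute ρ A} {B} (Orthogonal-permute {A = A} {B} ρ Perm.id A⊥B))) ⟩
    0# + s * 0#
      ≈⟨ trans (+-identityˡ _) (zeroʳ s) ⟩
    0# ∎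
    where
    a a′ b b′ : ℝ
    a  = Δ A
    a′ = Δ (flip A)
    b  = Δ B
    b′ = Δ (flip B)
    ρ = Perm.transpose 0F 2F ∘ₚ Perm.transpose 1F 3F
    exchange : ∀ a b c d → a - b - c + d ≈ a - c - b + d
    exchange = solve 4 (λ a b c d → a :- b :- c :+ d := a :- c :- b :+ d) refl
    swapped : Δ (permute ρ A) ≈ a′
    swapped = exchange _ _ _ _
    swappedᵀ : Δ (flip (permute ρ A)) ≈ a
    swappedᵀ = exchange _ _ _ _

  module _ {S : Grid (4 ℕ.+ m)} (diagonal : ∀ x → S x x ≈ 0#)
           (rows : ∀ x → sum (S x) ≈ 0#) (columns : ∀ y → sum (flip S y) ≈ 0#)
           (Δ≈0 : ∀ π → Δ (permute π S) ≈ 0#) where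

    private
      N : ℝ
      N = ⌜ 4 ℕ.+ m ⌝

      u : Fin (4 ℕ.+ m) → Fin (4 ℕ.+ m) → Fin (4 ℕ.+ m) → ℝ
      u a b c = S a c - S b c

      quadruple : ∀ {a b c d} → a ≢ b → a ≢ c → a ≢ d → b ≢ c → b ≢ d → c ≢ d →
                  u a b c - S a d + S b d ≈ 0#
      quadruple a≢b a≢c a≢d b≢c b≢d c≢d with realise₄ a≢b a≢c a≢d b≢c b≢d c≢d
      ... | π , ≡.refl , ≡.refl , ≡.refl , ≡.refl = Δ≈0 π

      -- The sum of `quadruple` over `d`. The case `d = c` holds trivially, so only `d = a` and
      -- `d = b` contribute to `sum f`, while the zero row sums reduce that sum to `N * u a b c`.
      triple : ∀ {a b c} → a ≢ b → a ≢ c → b ≢ c →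
               (N - ⌜ 2 ⌝) * u a b c - S b a + S a b ≈ 0#
      triple {a} {b} {c} a≢b a≢c b≢c = begin
        (N - ⌜ 2 ⌝) * u a b c - S b a + S a b
          ≈⟨ solve 4 (λ n u p q → (n :- con (+ 2)) :* u :- p :+ q :=
               n :* u :- ((u :+ p) :+ (u :- q))) refl N (u a b c) (S b a) (S a b) ⟩
        N * u a b c - ((u a b c + S b a) + (u a b c - S a b))
          ≈⟨ +-congˡ (-‿cong (+-cong
               (sym (+-congʳ (trans (+-congˡ (-‿cong (diagonal a))) minus-0)))
               (sym (trans (+-congˡ (diagonal b)) (+-identityʳ _))))) ⟩
        N * u a b c - (f a + f b)
          ≈⟨ +-cong (sym (trans total-f (solve 1 (λ x → x :- con (+ 0) :+ con (+ 0) := x) refl _)))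
                    (-‿cong (sym (sum-supported₂ f a b a≢b f≈0))) ⟩
        sum f - sum f
          ≈⟨ -‿inverseʳ _ ⟩
        0# ∎
        where
        minus-0 : ∀ {x} → x - 0# ≈ x
        minus-0 = trans (+-congˡ -0#≈0#) (+-identityʳ _)
        f : Vector ℝ (4 ℕ.+ m)
        f d = u a b c - S a d + S b d
        f≈0 : ∀ d → d ≢ a → d ≢ b → f d ≈ 0#
        f≈0 d d≢a d≢b with d ≟ᶠ c
        ... | yes ≡.refl = solve 2 (λ x y → x :- y :- x :+ y := con (+ 0)) refl (S a c) (S b c)
        ... | no d≢c = quadruple a≢b a≢c (≢-sym d≢a) b≢c (≢-sym d≢b) (≢-sym d≢c)
        total-f : sum f ≈ N * u a b c - 0# + 0#
        total-f = begin
          sum f                                        ≈⟨ ∑-distrib-+ (λ d → u a b c - S a d) (S b) ⟩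
          sum (λ d → u a b c - S a d) + sum (S b)      ≈⟨ +-cong (sum-minus (λ _ → u a b c) (S a)) (rows b) ⟩
          sum {4 ℕ.+ m} (λ _ → u a b c) - sum (S a) + 0# ≈⟨ +-congʳ (+-cong (sum-const (4 ℕ.+ m) _) (-‿cong (rows a))) ⟩
          N * u a b c - 0# + 0#                        ∎

    -- The sum of `triple` over `b`, where `b = a` is trivial and only `b = c` contributes. The
    -- total is `(N-2) N S(a,c)`, since rows and columns sum to zero; subtracting the term at `c`
    -- leaves the coefficient `N(N-2) - (N-2) - 1 = N(N-3) + 1`.
    pair : ∀ {a c} → a ≢ c → (N * (N - ⌜ 3 ⌝) + ⌜ 1 ⌝) * S a c + S c a ≈ 0#
    pair {a} {c} a≢c = begin
      (N * (N - ⌜ 3 ⌝) + ⌜ 1 ⌝) * S a c + S c a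
        ≈⟨ solve 3 (λ n p q → (n :* (n :- con (+ 3)) :+ con (+ 1)) :* p :+ q :=
             (n :- con (+ 2)) :* (n :* p) :- ((n :- con (+ 2)) :* p :- q :+ p)) refl N (S a c) (S c a) ⟩
      (N - ⌜ 2 ⌝) * (N * S a c) - ((N - ⌜ 2 ⌝) * S a c - S c a + S a c)
        ≈⟨ +-cong (sym total-g) (-‿cong (sym (trans (sum-supported₁ g c g≈0) g[c]))) ⟩
      sum g - sum g
        ≈⟨ -‿inverseʳ _ ⟩
      0# ∎
      where
      g : Vector ℝ (4 ℕ.+ m)
      g b = (N - ⌜ 2 ⌝) * u a b c - S b a + S a b
      g≈0 : ∀ b → b ≢ c → g b ≈ 0#
      g≈0 b b≢c with b ≟ᶠ a
      ... | yes ≡.refl = solve 3 (λ n x y → n :* (x :- x) :- y :+ y := con (+ 0)) refl (N - ⌜ 2 ⌝) (S a c) (S a a)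
      ... | no b≢a = triple (≢-sym b≢a) a≢c b≢c
      g[c] : g c ≈ (N - ⌜ 2 ⌝) * S a c - S c a + S a c
      g[c] = +-congʳ (+-congʳ (*-congˡ (trans (+-congˡ (trans (-‿cong (diagonal c)) -0#≈0#)) (+-identityʳ _))))
      total-g : sum g ≈ (N - ⌜ 2 ⌝) * (N * S a c)
      total-g = begin
        sum g
          ≈⟨ ∑-distrib-+ (λ b → (N - ⌜ 2 ⌝) * u a b c - S b a) (S a) ⟩
        sum (λ b → (N - ⌜ 2 ⌝) * u a b c - S b a) + sum (S a)
          ≈⟨ +-cong (sum-minus (λ b → (N - ⌜ 2 ⌝) * u a b c) (flip S a)) (rows a) ⟩
        sum (λ b → (N - ⌜ 2 ⌝) * u a b c) - sum (flip S a) + 0#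
          ≈⟨ +-congʳ (+-cong (trans (sum-*ˡ (N - ⌜ 2 ⌝) (λ b → u a b c))
               (*-congˡ (sum-minus (λ _ → S a c) (flip S c)))) (-‿cong (columns a))) ⟩
        (N - ⌜ 2 ⌝) * (sum {4 ℕ.+ m} (λ _ → S a c) - sum (flip S c)) - 0# + 0#
          ≈⟨ +-congʳ (+-congʳ (*-congˡ (+-cong (sum-const (4 ℕ.+ m) (S a c)) (-‿cong (columns c))))) ⟩
        (N - ⌜ 2 ⌝) * (N * S a c - 0#) - 0# + 0#
          ≈⟨ solve 2 (λ k x → k :* (x :- con (+ 0)) :- con (+ 0) :+ con (+ 0) := k :* x) refl (N - ⌜ 2 ⌝) (N * S a c) ⟩
        (N - ⌜ 2 ⌝) * (N * S a c) ∎

    Δ≈0⇒≈0 : ∀ s → ¬ (N * (N - ⌜ 3 ⌝) + ⌜ 1 ⌝ + s ≈ 0#) → (∀ x y → S y x ≈ s * S x y) →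
             ∀ x y → S x y ≈ 0#
    Δ≈0⇒≈0 s k≉0 S-sym x y with x ≟ᶠ y
    ... | yes ≡.refl = diagonal x
    ... | no x≢y = *-cancel-0 k≉0 (trans (distribʳ (S x y) (N * (N - ⌜ 3 ⌝) + ⌜ 1 ⌝) s)
                     (trans (+-congˡ (sym (S-sym x y))) (pair x≢y)))

  -- Composing `π` with a transposition changes two terms of the transversal sum, so the two
  -- diagonals of every 2 by 2 submatrix have equal sums. Hence rows are constant, and a constant
  -- row with sum zero is zero.
  transversals≈0⇒≈0 : (M : Fin (suc n) → Fin (suc n) → ℝ) →
    (∀ x → sum (M x) ≈ 0#) → (∀ y → sum (flip M y) ≈ 0#) →
    (∀ (π : Permutation′ (suc n)) → sum (λ x → M (π ⟨$⟩ʳ x) x) ≈ 0#) → ∀ x y → M x y ≈ 0#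
  transversals≈0⇒≈0 {n} M rows columns M≈0 c a = *-cancel-0 (⌜suc⌝≉0 n) (begin
    ⌜ suc n ⌝ * M c a                       ≈⟨ sum-const (suc n) (M c a) ⟨
    sum {suc n} (λ _ → M c a)               ≈⟨ sum-cong-≋ (λ b → row-constant b) ⟩
    sum (M c)                               ≈⟨ rows c ⟩
    0#                                      ∎)
    where
    minor : ∀ {a b c d} → a ≢ b → c ≢ d → M c a + M d b - (M d a + M c b) ≈ 0#
    minor {a} {b} a≢b c≢d with realise₂ a≢b c≢d
    ... | π , ≡.refl , ≡.refl = begin
      M (π ⟨$⟩ʳ a) a + M (π ⟨$⟩ʳ b) b - (M (π ⟨$⟩ʳ b) a + M (π ⟨$⟩ʳ a) b)
        ≈⟨ solve 4 (λ p q r s → p :+ q :- (r :+ s) := (p :- r) :+ (q :- s)) refl _ _ _ _ ⟩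
      (M (π ⟨$⟩ʳ a) a - M (π ⟨$⟩ʳ b) a) + (M (π ⟨$⟩ʳ b) b - M (π ⟨$⟩ʳ a) b)
        ≡⟨ ≡.cong₂ (λ i j → (M (π ⟨$⟩ʳ a) a - M (π ⟨$⟩ʳ i) a) + (M (π ⟨$⟩ʳ b) b - M (π ⟨$⟩ʳ j) b))
             (≡.sym (transpose-left a b)) (≡.sym (transpose-right a b)) ⟩
      f a + f b
        ≈⟨ sum-supported₂ f a b a≢b f≈0 ⟨
      sum f
        ≈⟨ sum-minus (λ x → M (π ⟨$⟩ʳ x) x) (λ x → M (π ⟨$⟩ʳ (τ ⟨$⟩ʳ x)) x) ⟩
      sum (λ x → M (π ⟨$⟩ʳ x) x) - sum (λ x → M (π ⟨$⟩ʳ (τ ⟨$⟩ʳ x)) x)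
        ≈⟨ +-cong (M≈0 π) (-‿cong (M≈0 (τ ∘ₚ π))) ⟩
      0# - 0#
        ≈⟨ -‿inverseʳ 0# ⟩
      0# ∎
      where
      τ = Perm.transpose a b
      f : Vector ℝ (suc n)
      f x = M (π ⟨$⟩ʳ x) x - M (π ⟨$⟩ʳ (τ ⟨$⟩ʳ x)) x
      f≈0 : ∀ x → x ≢ a → x ≢ b → f x ≈ 0#
      f≈0 x x≢a x≢b = trans
        (+-congˡ (-‿cong (reflexive (≡.cong (λ y → M (π ⟨$⟩ʳ y) x) (transpose-other x≢a x≢b)))))
        (-‿inverseʳ _)

    minor′ : ∀ b d → M c a + M d b - (M d a + M c b) ≈ 0#
    minor′ b d with a ≟ᶠ b | c ≟ᶠ d
    ... | yes ≡.refl | _ = solve 2 (λ p q → p :+ q :- (q :+ p) := con (+ 0)) refl (M c a) (M d a)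
    ... | no _ | yes ≡.refl = -‿inverseʳ _
    ... | no a≢b | no c≢d = minor a≢b c≢d

    -- In the sum of `minor′` over `d` the two column sums drop out, leaving `suc n` copies of
    -- `M c a - M c b`.
    row-constant : ∀ b → M c a ≈ M c b
    row-constant b = x∙y⁻¹≈ε⇒x≈y (M c a) (M c b) (*-cancel-0 (⌜suc⌝≉0 n) (begin
      ⌜ suc n ⌝ * (M c a - M c b)
        ≈⟨ sum-const (suc n) (M c a - M c b) ⟨
      sum {suc n} (λ _ → M c a - M c b)
        ≈⟨ solve 1 (λ x → x := x :+ con (+ 0) :- con (+ 0)) refl _ ⟩
      sum {suc n} (λ _ → M c a - M c b) + 0# - 0#
        ≈⟨ +-cong (+-congˡ (columns b)) (-‿cong (columns a)) ⟨
      sum {suc n} (λ _ → M c a - M c b) + sum (flip M b) - sum (flip M a)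
        ≈⟨ +-congʳ (∑-distrib-+ (λ _ → M c a - M c b) (flip M b)) ⟨
      sum (λ d → M c a - M c b + M d b) - sum (flip M a)
        ≈⟨ sum-minus (λ d → M c a - M c b + M d b) (flip M a) ⟨
      sum (λ d → M c a - M c b + M d b - M d a)
        ≈⟨ sum≈0 _ (λ d → trans (rearrange (M c a) (M c b) (M d b) (M d a)) (minor′ b d)) ⟩
      0# ∎))
      where
      rearrange : ∀ p q r s → p - q + r - s ≈ p + r - (s + q)
      rearrange = solve 4 (λ p q r s → p :- q :+ r :- s := p :+ r :- (s :+ q)) refl

-- Zero discrepancy as orthogonality

module Discrepancy {ℓ : Level} (R : RealNumbers ℓ) where
  open Weights R
  open OrderedField R
  open Sums R
  open Grids R
  open Relation.Binary.Reasoning.Setoid setoid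
  open Data.List.Extrema totalOrder using (xs≤max; min≤xs; max≤v⁺; v≤min⁺; ⊥≤max; min≤⊤)
  open Algebra.Construct.NaturalChoice.Max totalOrder using (x≤x⊔y; x≤y⊔x; ⊔-cong; ⊔-idem)

  private variable n : ℕ

  extend-off : (w : Weight n) → ∀ {x y} (x≢y : x ≢ y) → extend w x y ≡ w x y x≢y
  extend-off w {x} {y} x≢y with x ≟ᶠ y
  ... | yes x≡y = ⊥-elim (x≢y x≡y)
  ... | no  _   = ≡.refl

  extend-diagonal : (w : Weight n) → ∀ x → extend w x x ≡ 0#
  extend-diagonal w x with x ≟ᶠ x
  ... | yes _   = ≡.refl
  ... | no  x≢x = ⊥-elim (x≢x ≡.refl)

  extend-relabel : ∀ π (w : Weight n) x y → extend (relabel π w) x y ≡ permute (Perm.flip π) (extend w) x y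
  extend-relabel π w x y with x ≟ᶠ y
  ... | yes ≡.refl = ≡.sym (extend-diagonal w (π ⟨$⟩ˡ x))
  ... | no  x≢y    = ≡.sym (extend-off w _)

  pairing : (w u : Weight n) → ⟨ w , u ⟩ ≈ inner (extend w) (extend u)
  pairing w u = ∑∑-cong product
    where
    product : ∀ x y → extend (λ x y x≢y → w x y x≢y * u x y x≢y) x y ≈ extend w x y * extend u x y
    product x y with x ≟ᶠ y
    ... | yes _ = sym (zeroˡ 0#)
    ... | no  _ = refl

  pairing-relabel : ∀ π (w u : Weight n) →
                    ⟨ relabel π w , u ⟩ ≈ inner (permute (Perm.flip π) (extend w)) (extend u)
  pairing-relabel π w u = trans (pairing (relabel π w) u)
    (inner-congˡ (extend u) λ x y → reflexive (extend-relabel π w x y))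

  module _ {f : Permutation′ n → ℝ} (f-cong : ∀ π ρ → π Perm.≈ ρ → f π ≈ f ρ) where

    f≤max : ∀ π → f π ≤ maxₚ f
    f≤max π = All.lookupWith (λ { fρ≤max ρ≈π → ≤-respˡ-≈ (f-cong _ _ ρ≈π) fρ≤max })
      (All.map⁻ (xs≤max (f Perm.id) (List.map f (permutations _)))) (permutations-complete π)

    min≤f : ∀ π → minₚ f ≤ f π
    min≤f π = All.lookupWith (λ { min≤fρ ρ≈π → ≤-respʳ-≈ (f-cong _ _ ρ≈π) min≤fρ })
      (All.map⁻ (min≤xs (f Perm.id) (List.map f (permutations _)))) (permutations-complete π)

  max≈0 : {f : Permutation′ n → ℝ} → (∀ π → f π ≈ 0#) → maxₚ f ≈ 0#
  max≈0 {f = f} f≈0 = antisym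
    (max≤v⁺ (≤-reflexive (f≈0 Perm.id)) (All.map⁺ (All.universal (λ π → ≤-reflexive (f≈0 π)) (permutations _))))
    (≤-respˡ-≈ (f≈0 Perm.id) (⊥≤max (f Perm.id) (List.map f (permutations _))))

  min≈0 : {f : Permutation′ n → ℝ} → (∀ π → f π ≈ 0#) → minₚ f ≈ 0#
  min≈0 {f = f} f≈0 = antisym
    (≤-respʳ-≈ (f≈0 Perm.id) (min≤⊤ (f Perm.id) (List.map f (permutations _))))
    (v≤min⁺ (≤-reflexive (sym (f≈0 Perm.id))) (All.map⁺ (All.universal (λ π → ≤-reflexive (sym (f≈0 π))) (permutations _))))

  -- The list `permutations` contains a permutation only up to pointwise equality; this carries the
  -- bounds given by the extrema over to an arbitrary `π`.
  relabel-cong : ∀ (w u : Weight n) π ρ → π Perm.≈ ρ → ⟨ relabel π w , u ⟩ ≈ ⟨ relabel ρ w , u ⟩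
  relabel-cong w u π ρ π≈ρ = begin
    ⟨ relabel π w , u ⟩
      ≈⟨ pairing-relabel π w u ⟩
    inner (permute (Perm.flip π) (extend w)) (extend u)
      ≈⟨ inner-congˡ (extend u) (λ x y → reflexive (≡.cong₂ (extend w) (from≡ x) (from≡ y))) ⟩
    inner (permute (Perm.flip ρ) (extend w)) (extend u)
      ≈⟨ pairing-relabel ρ w u ⟨
    ⟨ relabel ρ w , u ⟩ ∎
    where
    from≡ : ∀ x → π ⟨$⟩ˡ x ≡ ρ ⟨$⟩ˡ x
    from≡ x = ≡.trans (≡.sym (inverseˡ ρ))
      (≡.cong (ρ ⟨$⟩ˡ_) (≡.trans (≡.sym (π≈ρ (π ⟨$⟩ˡ x))) (inverseʳ π)))

  -- The density term vanishes because `w` is centered. Zero discrepancy then says that the maximum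
  -- is at most 0 and the minimum at least 0, which pins every pairing to 0.
  disc≈0⇔orthogonal : (w u : Weight n) → Centered w →
                      disc w u ≈ 0# ⇔ Orthogonal (extend w) (extend u)
  disc≈0⇔orthogonal {n} w u centered = mk⇔ to from
    where
    f : Permutation′ n → ℝ
    f π = ⟨ relabel π w , u ⟩
    e : ℝ
    e = density w * density u * ⌜ n ⌝ * (⌜ n ⌝ - ⌜ 1 ⌝)
    e≈0 : e ≈ 0#
    e≈0 = trans (*-congʳ (trans (*-congʳ (trans (*-congʳ (trans (*-congʳ centered) (zeroˡ _)))
      (zeroˡ _))) (zeroˡ _))) (zeroˡ _)
    disc⁺≈ : disc⁺ w u ≈ maxₚ f
    disc⁺≈ = trans (+-congˡ (trans (-‿cong e≈0) -0#≈0#)) (+-identityʳ _)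
    disc⁻≈ : disc⁻ w u ≈ - minₚ f
    disc⁻≈ = trans (+-congʳ e≈0) (+-identityˡ _)
    to : disc w u ≈ 0# → Orthogonal (extend w) (extend u)
    -- `relabel` moves by the inverse permutation and `permute` by the permutation itself, hence
    -- `Perm.flip`.
    to disc≈0 π = trans (sym (pairing-relabel (Perm.flip π) w u)) (antisym
      (≤-trans (f≤max (relabel-cong w u) (Perm.flip π))
        (≤-respˡ-≈ disc⁺≈ (≤-respʳ-≈ disc≈0 (x≤x⊔y (disc⁺ w u) (disc⁻ w u)))))
      (≤-trans (-x≤0⇒0≤x (≤-respˡ-≈ disc⁻≈ (≤-respʳ-≈ disc≈0 (x≤y⊔x (disc⁺ w u) (disc⁻ w u)))))
        (min≤f (relabel-cong w u) (Perm.flip π))))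
    from : Orthogonal (extend w) (extend u) → disc w u ≈ 0#
    from w⊥u = trans (⊔-cong
        (trans disc⁺≈ (max≈0 f≈0))
        (trans disc⁻≈ (trans (-‿cong (min≈0 f≈0)) -0#≈0#)))
      (⊔-idem 0#)
      where
      f≈0 : ∀ π → f π ≈ 0#
      f≈0 π = trans (pairing-relabel π w u) (w⊥u (Perm.flip π))

-- Splitting a weight into marginals and a residual

module Decomposition {ℓ : Level} (R : RealNumbers ℓ) {m : ℕ} where
  open Weights R
  open OrderedField R
  open Sums R
  open Grids R
  open Discrepancy R
  open Relation.Binary.Reasoning.Setoid setoid

  n : ℕ
  n = 4 ℕ.+ m

  N : ℝ
  N = ⌜ n ⌝

  Residual : Weight n → Grid n
  Residual w = extend (h w)

  N-2≈ : N - ⌜ 2 ⌝ ≈ ⌜ 2 ℕ.+ m ⌝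
  N-2≈ = ⌜m+n⌝-⌜m⌝≈⌜n⌝ 2 (2 ℕ.+ m)

  2[N-2]≉0 : ¬ (⌜ 2 ⌝ * (N - ⌜ 2 ⌝) ≈ 0#)
  2[N-2]≉0 = *≉0 (⌜suc⌝≉0 1) λ eq → ⌜suc⌝≉0 (1 ℕ.+ m) (trans (sym N-2≈) eq)

  2N≉0 : ¬ (⌜ 2 ⌝ * N ≈ 0#)
  2N≉0 = *≉0 (⌜suc⌝≉0 1) (⌜suc⌝≉0 (3 ℕ.+ m))

  0≤2[N-2] : 0# ≤ ⌜ 2 ⌝ * (N - ⌜ 2 ⌝)
  0≤2[N-2] = *-nonNeg (⌜⌝-nonNeg 2) (≤-respʳ-≈ (sym N-2≈) (⌜⌝-nonNeg (2 ℕ.+ m)))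

  0≤2N : 0# ≤ ⌜ 2 ⌝ * N
  0≤2N = *-nonNeg (⌜⌝-nonNeg 2) (⌜⌝-nonNeg n)

  -- g⁺ w + g⁻ w takes the value a w x + b w y at (x , y).
  a b : Weight n → Vector ℝ n
  a w x = p w x + q w x
  b w x = p w x - q w x

  module _ (w : Weight n) where

    -- Half the sum of `2(N-2) p = r + c` and `2N q = r - c`; half their difference gives `c≈`.
    r≈ : ∀ x → r w x ≈ (N - ⌜ 2 ⌝) * p w x + N * q w x
    r≈ x = x∙y⁻¹≈ε⇒x≈y _ _ (*-cancel-0 (⌜suc⌝≉0 1) (begin
      ⌜ 2 ⌝ * (r w x - ((N - ⌜ 2 ⌝) * p w x + N * q w x))
        ≈⟨ solve 5 (λ r c n p q → con (+ 2) :* (r :- ((n :- con (+ 2)) :* p :+ n :* q)) :=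
             (r :+ c) :+ (r :- c) :- (con (+ 2) :* (n :- con (+ 2)) :* p :+ con (+ 2) :* n :* q))
             refl (r w x) (c w x) N (p w x) (q w x) ⟩
      (r w x + c w x) + (r w x - c w x) - (⌜ 2 ⌝ * (N - ⌜ 2 ⌝) * p w x + ⌜ 2 ⌝ * N * q w x)
        ≈⟨ +-congˡ (-‿cong (+-cong (x*[y/x]≈y _ 2[N-2]≉0) (x*[y/x]≈y _ 2N≉0))) ⟩
      (r w x + c w x) + (r w x - c w x) - ((r w x + c w x) + (r w x - c w x))
        ≈⟨ -‿inverseʳ _ ⟩
      0# ∎))

    c≈ : ∀ x → c w x ≈ (N - ⌜ 2 ⌝) * p w x - N * q w x
    c≈ x = x∙y⁻¹≈ε⇒x≈y _ _ (*-cancel-0 (⌜suc⌝≉0 1) (begin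
      ⌜ 2 ⌝ * (c w x - ((N - ⌜ 2 ⌝) * p w x - N * q w x))
        ≈⟨ solve 5 (λ r c n p q → con (+ 2) :* (c :- ((n :- con (+ 2)) :* p :- n :* q)) :=
             (r :+ c) :- (r :- c) :- (con (+ 2) :* (n :- con (+ 2)) :* p :- con (+ 2) :* n :* q))
             refl (r w x) (c w x) N (p w x) (q w x) ⟩
      (r w x + c w x) - (r w x - c w x) - (⌜ 2 ⌝ * (N - ⌜ 2 ⌝) * p w x - ⌜ 2 ⌝ * N * q w x)
        ≈⟨ +-congˡ (-‿cong (+-cong (x*[y/x]≈y _ 2[N-2]≉0) (-‿cong (x*[y/x]≈y _ 2N≉0)))) ⟩
      (r w x + c w x) - (r w x - c w x) - ((r w x + c w x) - (r w x - c w x))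
        ≈⟨ -‿inverseʳ _ ⟩
      0# ∎))

    decomposition : ∀ {x y} → x ≢ y → extend w x y ≈ a w x + b w y + Residual w x y
    decomposition {x} {y} x≢y = begin
      extend w x y    ≡⟨ extend-off w x≢y ⟩
      w x y x≢y
        ≈⟨ solve 5 (λ w p q p′ q′ → w := p :+ q :+ (p′ :- q′) :+ (w :- (p :+ p′) :- (q :- q′)))
             refl (w x y x≢y) (p w x) (q w x) (p w y) (q w y) ⟩
      a w x + b w y + h w x y x≢y                 ≡⟨ ≡.cong (λ z → a w x + b w y + z) (extend-off (h w) x≢y) ⟨
      a w x + b w y + Residual w x y              ∎

  module _ (w : Weight n) (centered : Centered w) where

    sum-r≈0 : sum (r w) ≈ 0#
    sum-r≈0 = centered

    sum-c≈0 : sum (c w) ≈ 0#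
    sum-c≈0 = trans (∑-comm (flip (extend w))) centered

    sum-p≈0 : sum (p w) ≈ 0#
    sum-p≈0 = trans (sum-*ʳ _ (λ x → r w x + c w x)) (trans (*-congʳ (trans (∑-distrib-+ (r w) (c w))
      (trans (+-cong sum-r≈0 sum-c≈0) (+-identityˡ 0#)))) (zeroˡ _))

    sum-q≈0 : sum (q w) ≈ 0#
    sum-q≈0 = trans (sum-*ʳ _ (λ x → r w x - c w x)) (trans (*-congʳ (trans (sum-minus (r w) (c w))
      (trans (+-cong sum-r≈0 (-‿cong sum-c≈0)) (-‿inverseʳ 0#)))) (zeroˡ _))

    sum-a≈0 : sum (a w) ≈ 0#
    sum-a≈0 = trans (∑-distrib-+ (p w) (q w)) (trans (+-cong sum-p≈0 sum-q≈0) (+-identityˡ 0#))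

    sum-b≈0 : sum (b w) ≈ 0#
    sum-b≈0 = trans (sum-minus (p w) (q w)) (trans (+-cong sum-p≈0 (-‿cong sum-q≈0)) (-‿inverseʳ 0#))

    residual-diagonal : ∀ x → Residual w x x ≈ 0#
    residual-diagonal x = reflexive (extend-diagonal (h w) x)

    private
      -- At `y = x` both `W` and `H` vanish but `k + v x` does not. Summing the decomposition over
      -- the whole line therefore counts one term too many, and `k + v x` corrects for it.
      sum-residual : (W H v : Vector ℝ n) (k : ℝ) (x : Fin n) → sum v ≈ 0# → W x ≈ 0# → H x ≈ 0# →
                     (∀ y → y ≢ x → W y ≈ k + v y + H y) → sum H ≈ sum W - N * k + (k + v x)
      sum-residual W H v k x Σv≈0 Wx≈0 Hx≈0 W≈ = begin
        sum H
          ≈⟨ solve 4 (λ s k v f → s := (k :+ v :+ s) :- k :- v) refl (sum H) (N * k) (sum v) (sum H) ⟩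
        (N * k + sum v + sum H) - N * k - sum v
          ≈⟨ +-cong (+-congʳ (sym total-g)) (trans (-‿cong Σv≈0) -0#≈0#) ⟩
        sum g - N * k + 0#
          ≈⟨ solve 3 (λ g k w → g :- k :+ con (+ 0) := w :- k :- (w :- g)) refl (sum g) (N * k) (sum W) ⟩
        sum W - N * k - (sum W - sum g)
          ≈⟨ +-congˡ (-‿cong (trans (sym (sum-minus W g)) (sum-supported₁ (λ y → W y - g y) x off))) ⟩
        sum W - N * k - (W x - (k + v x + H x))
          ≈⟨ +-congˡ (-‿cong (+-cong Wx≈0 (-‿cong (+-congˡ Hx≈0)))) ⟩
        sum W - N * k - (0# - (k + v x + 0#))
          ≈⟨ +-congˡ (solve 1 (λ z → :- (con (+ 0) :- (z :+ con (+ 0))) := z) refl (k + v x)) ⟩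
        sum W - N * k + (k + v x) ∎
        where
        g : Vector ℝ n
        g y = k + v y + H y
        total-g : sum g ≈ N * k + sum v + sum H
        total-g = trans (∑-distrib-+ (λ y → k + v y) H)
          (+-congʳ (trans (∑-distrib-+ (λ _ → k) v) (+-congʳ (sum-const n k))))
        off : ∀ y → y ≢ x → W y - g y ≈ 0#
        off y y≢x = trans (+-congʳ (W≈ y y≢x)) (-‿inverseʳ _)

    -- Here the normalisation of `p` and `q` is decisive: with `a = p + q` and `a + b = 2p`, the row
    -- sum is `(N-2)p + Nq - N(p+q) + 2p = 0`.
    residual-rows : ∀ x → sum (Residual w x) ≈ 0#
    residual-rows x = begin
      sum (Residual w x)
        ≈⟨ sum-residual (extend w x) (Residual w x) (b w) (a w x) x sum-b≈0
             (reflexive (extend-diagonal w x)) (residual-diagonal x) (λ y y≢x → decomposition w (≢-sym y≢x)) ⟩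
      r w x - N * a w x + (a w x + b w x)
        ≈⟨ +-congʳ (+-congʳ (r≈ w x)) ⟩
      (N - ⌜ 2 ⌝) * p w x + N * q w x - N * a w x + (a w x + b w x)
        ≈⟨ solve 3 (λ n p q → (n :- con (+ 2)) :* p :+ n :* q :- n :* (p :+ q) :+ (p :+ q :+ (p :- q)) :=
             con (+ 0)) refl N (p w x) (q w x) ⟩
      0# ∎

    residual-columns : ∀ x → sum (flip (Residual w) x) ≈ 0#
    residual-columns x = begin
      sum (flip (Residual w) x)
        ≈⟨ sum-residual (flip (extend w) x) (flip (Residual w) x) (a w) (b w x) x sum-a≈0
             (reflexive (extend-diagonal w x)) (residual-diagonal x)
             (λ y y≢x → trans (decomposition w y≢x) (+-congʳ (+-comm _ _))) ⟩
      c w x - N * b w x + (b w x + a w x)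
        ≈⟨ +-congʳ (+-congʳ (c≈ w x)) ⟩
      (N - ⌜ 2 ⌝) * p w x - N * q w x - N * b w x + (b w x + a w x)
        ≈⟨ solve 3 (λ n p q → (n :- con (+ 2)) :* p :- n :* q :- n :* (p :- q) :+ (p :- q :+ (p :+ q)) :=
             con (+ 0)) refl N (p w x) (q w x) ⟩
      0# ∎

-- Gram matrices and their column spaces

module Gram {ℓ : Level} (R : RealNumbers ℓ) where
  open Weights R
  open OrderedField R
  open Sums R
  open Grids R
  open Relation.Binary.Reasoning.Setoid setoid

  private variable n m k : ℕ

  dot-comm : (v w : Vector ℝ n) → dot v w ≈ dot w v
  dot-comm v w = sum-cong-≋ λ i → *-comm (v i) (w i)

  dot-nonNeg : (v : Vector ℝ n) → 0# ≤ dot v v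
  dot-nonNeg v = sum-nonNeg _ λ i → square-nonNeg (v i)

  dot≈0⇒≈0 : (v : Vector ℝ n) → dot v v ≈ 0# → ∀ i → v i ≈ 0#
  dot≈0⇒≈0 v eq i = square≈0⇒≈0 (nonNeg-sum≈0 _ (λ i → square-nonNeg (v i)) eq i)

  dot-congʳ : (v : Vector ℝ n) {w w′ : Vector ℝ n} → (∀ i → w i ≈ w′ i) → dot v w ≈ dot v w′
  dot-congʳ v w≈w′ = sum-cong-≋ λ i → *-congˡ (w≈w′ i)

  dot-linearCombination : (v : Vector ℝ n) (c : Vector ℝ k) (b : Vector (Vector ℝ n) k) →
                          dot v (linearCombination c b) ≈ ∑[ j < k ] (c j * dot v (b j))
  dot-linearCombination {n} {k} v c b = begin
    ∑[ i < n ] (v i * ∑[ j < k ] (c j * b j i))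
      ≈⟨ sum-cong-≋ (λ i → *-distribˡ-sum (v i) (λ j → c j * b j i)) ⟩
    ∑[ i < n ] ∑[ j < k ] (v i * (c j * b j i))
      ≈⟨ ∑-comm (λ i j → v i * (c j * b j i)) ⟩
    ∑[ j < k ] ∑[ i < n ] (v i * (c j * b j i))
      ≈⟨ ∑∑-cong (λ j i → solve 3 (λ x y z → x :* (y :* z) := y :* (x :* z)) refl (v i) (c j) (b j i)) ⟩
    ∑[ j < k ] ∑[ i < n ] (c j * (v i * b j i))
      ≈⟨ sum-cong-≋ (λ j → sum-*ˡ (c j) (λ i → v i * b j i)) ⟩
    ∑[ j < k ] (c j * dot v (b j)) ∎

  ⊥-Span : (v : Vector ℝ n) (b : Vector (Vector ℝ n) k) → (∀ j → dot v (b j) ≈ 0#) →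
           ∀ {w} → Span b w → dot v w ≈ 0#
  ⊥-Span v b v⊥b (c , w≈) = trans (dot-congʳ v w≈) (trans (dot-linearCombination v c b)
    (sum≈0 _ λ j → trans (*-congˡ (v⊥b j)) (zeroʳ (c j))))

  Span-⊥-Span : {b : Vector (Vector ℝ n) k} {b′ : Vector (Vector ℝ n) m} →
                (∀ i j → dot (b i) (b′ j) ≈ 0#) → Span b ⊥ₛ Span b′
  Span-⊥-Span {b = b} {b′} b⊥b′ {v} {w} v∈ w∈ = ⊥-Span v b′
    (λ j → trans (dot-comm v (b′ j)) (⊥-Span (b′ j) b (λ i → trans (dot-comm (b′ j) (b i)) (b⊥b′ i j)) {v} v∈)) {w} w∈

  basis∈Span : (b : Vector (Vector ℝ n) k) → ∀ j → Span b (b j)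
  basis∈Span {k = k} b j = δ , λ i → sym (begin
    ∑[ l < k ] (δ l * b l i)   ≈⟨ sum-supported₁ _ j (λ l l≢j → trans (*-congʳ (δ-off l l≢j)) (zeroˡ _)) ⟩
    δ j * b j i                ≈⟨ *-congʳ δ-on ⟩
    1# * b j i                 ≈⟨ *-identityˡ _ ⟩
    b j i                      ∎)
    where
    δ : Vector ℝ k
    δ l with l ≟ᶠ j
    ... | yes _ = 1#
    ... | no  _ = 0#
    δ-on : δ j ≈ 1#
    δ-on with j ≟ᶠ j
    ... | yes _   = refl
    ... | no  j≢j = ⊥-elim (j≢j ≡.refl)
    δ-off : ∀ l → l ≢ j → δ l ≈ 0#
    δ-off l l≢j with l ≟ᶠ j
    ... | yes l≡j = ⊥-elim (l≢j l≡j)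
    ... | no  _   = refl

  γ : Weight n → Fin 2 → Vector ℝ n
  γ w 0F = α w
  γ w 1F = β w

  Γ-column : Weight n → Fin 2 → Vector ℝ 2
  Γ-column w j i = Γ w i j

  Γ≈ : (w : Weight n) → ∀ i j → Γ w i j ≈ dot (γ w i) (γ w j)
  Γ≈ w 0F 0F = refl
  Γ≈ w 0F 1F = refl
  Γ≈ w 1F 0F = dot-comm (α w) (β w)
  Γ≈ w 1F 1F = refl

  M : Weight n → Weight n → Grid n
  M w u x y = α w x * α u y + β w x * β u y

  -- A product of two Gram entries is a double sum over `x` and `y`. Adding the products for the `α`
  -- row and the `β` row makes `M w u x y` a common factor of each term.
  dot-Γ-columns : (w u : Weight n) → ∀ i j → dot (Γ-column w i) (Γ-column u j) ≈
                  ∑[ x < n ] ∑[ y < n ] (γ w i x * γ u j y * M w u x y)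
  dot-Γ-columns {n} w u i j = begin
    Γ w 0F i * Γ u 0F j + (Γ w 1F i * Γ u 1F j + 0#)
      ≈⟨ +-cong (product 0F) (trans (+-identityʳ _) (product 1F)) ⟩
    ∑[ x < n ] ∑[ y < n ] ((α w x * γ w i x) * (α u y * γ u j y)) +
    ∑[ x < n ] ∑[ y < n ] ((β w x * γ w i x) * (β u y * γ u j y))
      ≈⟨ ∑∑-distrib-+ (λ x y → (α w x * γ w i x) * (α u y * γ u j y))
                      (λ x y → (β w x * γ w i x) * (β u y * γ u j y)) ⟨
    ∑[ x < n ] ∑[ y < n ] ((α w x * γ w i x) * (α u y * γ u j y) + (β w x * γ w i x) * (β u y * γ u j y))
      ≈⟨ ∑∑-cong (λ x y → factor (α w x) (β w x) (γ w i x) (α u y) (β u y) (γ u j y)) ⟩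
    ∑[ x < n ] ∑[ y < n ] (γ w i x * γ u j y * M w u x y) ∎
    where
    product : ∀ k → Γ w k i * Γ u k j ≈ ∑[ x < n ] ∑[ y < n ] ((γ w k x * γ w i x) * (γ u k y * γ u j y))
    product k = trans (*-cong (Γ≈ w k i) (Γ≈ u k j)) (sum*sum (λ x → γ w k x * γ w i x) (λ y → γ u k y * γ u j y))
    factor : ∀ a b g a′ b′ g′ → (a * g) * (a′ * g′) + (b * g) * (b′ * g′) ≈ g * g′ * (a * a′ + b * b′)
    factor = solve 6 (λ a b g a′ b′ g′ → (a :* g) :* (a′ :* g′) :+ (b :* g) :* (b′ :* g′) :=
                        g :* g′ :* (a :* a′ :+ b :* b′)) refl

  -- tr (Γ_w Γ_u) is the sum of the dot products of corresponding columns, both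
  -- matrices being symmetric.
  trace≈ : (w u : Weight n) → trace (Γ w ⊗ Γ u) ≈ ∑[ x < n ] ∑[ y < n ] (M w u x y * M w u x y)
  trace≈ {n} w u = begin
    dot (Γ-column w 0F) (Γ-column u 0F) + (dot (Γ-column w 1F) (Γ-column u 1F) + 0#)
      ≈⟨ +-cong (dot-Γ-columns w u 0F 0F) (trans (+-identityʳ _) (dot-Γ-columns w u 1F 1F)) ⟩
    ∑[ x < n ] ∑[ y < n ] (α w x * α u y * M w u x y) + ∑[ x < n ] ∑[ y < n ] (β w x * β u y * M w u x y)
      ≈⟨ ∑∑-distrib-+ (λ x y → α w x * α u y * M w u x y) (λ x y → β w x * β u y * M w u x y) ⟨
    ∑[ x < n ] ∑[ y < n ] (α w x * α u y * M w u x y + β w x * β u y * M w u x y)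
      ≈⟨ ∑∑-cong (λ x y → sym (distribʳ (M w u x y) (α w x * α u y) (β w x * β u y))) ⟩
    ∑[ x < n ] ∑[ y < n ] (M w u x y * M w u x y) ∎

  trace≈0⇒M≈0 : (w u : Weight n) → trace (Γ w ⊗ Γ u) ≈ 0# → ∀ x y → M w u x y ≈ 0#
  trace≈0⇒M≈0 w u eq x y = square≈0⇒≈0
    (nonNeg-sum≈0 _ (λ y → square-nonNeg (M w u x y))
      (nonNeg-sum≈0 _ (λ x → sum-nonNeg _ λ y → square-nonNeg (M w u x y)) (trans (sym (trace≈ w u)) eq) x) y)

  M≈0⇒trace≈0 : (w u : Weight n) → (∀ x y → M w u x y ≈ 0#) → trace (Γ w ⊗ Γ u) ≈ 0#
  M≈0⇒trace≈0 w u M≈0 = trans (trace≈ w u)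
    (sum≈0 _ λ x → sum≈0 _ λ y → trans (*-congʳ (M≈0 x y)) (zeroˡ _))

  -- The trace involves only columns with equal index, but as a sum of squares of `M` it forces `M`
  -- to vanish, and `M` is a factor in the product of any two columns.
  trace≈0⇒columns-⊥ : (w u : Weight n) → trace (Γ w ⊗ Γ u) ≈ 0# →
                       ∀ i j → dot (Γ-column w i) (Γ-column u j) ≈ 0#
  trace≈0⇒columns-⊥ w u eq i j = trans (dot-Γ-columns w u i j)
    (sum≈0 _ λ x → sum≈0 _ λ y → trans (*-congˡ (trace≈0⇒M≈0 w u eq x y)) (zeroʳ _))

  trace≈0⇔⊥ : (w u : Weight n) → trace (Γ w ⊗ Γ u) ≈ 0# ⇔ columnSpace (Γ w) ⊥ₛ columnSpace (Γ u)
  trace≈0⇔⊥ w u = mk⇔ to from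
    where
    to : trace (Γ w ⊗ Γ u) ≈ 0# → columnSpace (Γ w) ⊥ₛ columnSpace (Γ u)
    to eq = Span-⊥-Span {b = Γ-column w} {Γ-column u} (trace≈0⇒columns-⊥ w u eq)
    from : columnSpace (Γ w) ⊥ₛ columnSpace (Γ u) → trace (Γ w ⊗ Γ u) ≈ 0#
    from Γw⊥Γu = trans (+-cong (diagonal 0F) (trans (+-identityʳ _) (diagonal 1F))) (+-identityˡ 0#)
      where
      diagonal : ∀ i → dot (Γ-column w i) (Γ-column u i) ≈ 0#
      diagonal i = Γw⊥Γu {Γ-column w i} {Γ-column u i} (basis∈Span (Γ-column w) i) (basis∈Span (Γ-column u) i)

-- Characterisation of zero discrepancy

decide : ∀ {p q} {P : Set p} {Q : Set q} → Dec P → (¬ P → Q) → P ⊎ Q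
decide (yes p) _  = inj₁ p
decide (no ¬p) ¬p⇒q = inj₂ (¬p⇒q ¬p)

module Characterisation {ℓ : Level} (R : RealNumbers ℓ) {m : ℕ} where
  open Weights R
  open OrderedField R
  open Sums R
  open Grids R
  open Quadruples R
  open Vanishing R
  open Discrepancy R
  open Decomposition R {m}
  open Gram R
  open Relation.Binary.Reasoning.Setoid setoid

  -- The number factors as `(N-1)(N-2)` for `s = 1` and is `N(N-3)` for `s = -1`; with `n = 4 + m`
  -- all factors are positive numerals.
  ±-numeral≉0 : ∀ s → s ≈ 1# ⊎ s ≈ - 1# → ¬ (N * (N - ⌜ 3 ⌝) + ⌜ 1 ⌝ + s ≈ 0#)
  ±-numeral≉0 s (inj₁ s≈1) eq = *≉0 (⌜suc⌝≉0 (2 ℕ.+ m)) (⌜suc⌝≉0 (1 ℕ.+ m)) (begin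
    ⌜ 3 ℕ.+ m ⌝ * ⌜ 2 ℕ.+ m ⌝
      ≈⟨ *-cong (⌜m+n⌝-⌜m⌝≈⌜n⌝ 1 (3 ℕ.+ m)) (⌜m+n⌝-⌜m⌝≈⌜n⌝ 2 (2 ℕ.+ m)) ⟨
    (N - ⌜ 1 ⌝) * (N - ⌜ 2 ⌝)
      ≈⟨ solve 1 (λ n → (n :- con (+ 1)) :* (n :- con (+ 2)) :=
           n :* (n :- con (+ 3)) :+ con (+ 1) :+ con (+ 1)) refl N ⟩
    N * (N - ⌜ 3 ⌝) + ⌜ 1 ⌝ + ⌜ 1 ⌝
      -- `⌜ 1 ⌝` unfolds to `1# + 0#`.
      ≈⟨ +-congˡ (trans (+-identityʳ 1#) (sym s≈1)) ⟩
    N * (N - ⌜ 3 ⌝) + ⌜ 1 ⌝ + s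
      ≈⟨ eq ⟩
    0# ∎)
  ±-numeral≉0 s (inj₂ s≈-1) eq = *≉0 (⌜suc⌝≉0 (3 ℕ.+ m)) (⌜suc⌝≉0 m) (begin
    N * ⌜ 1 ℕ.+ m ⌝
      ≈⟨ *-congˡ (⌜m+n⌝-⌜m⌝≈⌜n⌝ 3 (1 ℕ.+ m)) ⟨
    N * (N - ⌜ 3 ⌝)
      ≈⟨ solve 1 (λ n → n :* (n :- con (+ 3)) := n :* (n :- con (+ 3)) :+ con (+ 1) :- con (+ 1)) refl N ⟩
    N * (N - ⌜ 3 ⌝) + ⌜ 1 ⌝ - ⌜ 1 ⌝
      ≈⟨ +-congˡ (trans (-‿cong (+-identityʳ 1#)) (sym s≈-1)) ⟩
    N * (N - ⌜ 3 ⌝) + ⌜ 1 ⌝ + s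
      ≈⟨ eq ⟩
    0# ∎)

  ±-square : ∀ s → s ≈ 1# ⊎ s ≈ - 1# → s * s ≈ 1#
  ±-square s (inj₁ s≈1)  = trans (*-cong s≈1 s≈1) (*-identityˡ 1#)
  ±-square s (inj₂ s≈-1) = trans (*-cong s≈-1 s≈-1)
    (trans (solve 1 (λ x → :- x :* :- x := x :* x) refl 1#) (*-identityˡ 1#))

  -- The conditions `h⁺ = 0` (for `s = 1`) and `h⁻ = 0` (for `s = -1`) on the full grid, without the
  -- factor one half; on the diagonal they hold automatically.
  Twisted≈0 : ℝ → Weight n → Set ℓ
  Twisted≈0 s w = ∀ x y → twist s (Residual w) x y ≈ 0#

  half≈0⇒≈0 : ∀ {x} → x / ⌜ 2 ⌝ ≈ 0# → x ≈ 0#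
  half≈0⇒≈0 {x} eq = trans (sym (x*[y/x]≈y x (⌜suc⌝≉0 1))) (trans (*-congˡ eq) (zeroʳ _))

  h⁺≐𝟘⇔ : ∀ w → h⁺ w ≐ 𝟘 ⇔ Twisted≈0 1# w
  h⁺≐𝟘⇔ w = mk⇔ to λ eq x y x≢y → trans (*-congʳ (trans (sym (twist≈ x≢y)) (eq x y))) (zeroˡ _)
    where
    twist≈ : ∀ {x y} (x≢y : x ≢ y) → twist 1# (Residual w) x y ≈ h w x y x≢y + (h w ᵀ) x y x≢y
    twist≈ x≢y = +-cong (reflexive (extend-off (h w) x≢y))
      (trans (*-identityˡ _) (reflexive (extend-off (h w) (≢-sym x≢y))))
    to : h⁺ w ≐ 𝟘 → Twisted≈0 1# w
    to h⁺≈0 x y with x ≟ᶠ y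
    ... | no x≢y = trans (+-congʳ (reflexive (≡.sym (extend-off (h w) x≢y)))) (trans (twist≈ x≢y) (half≈0⇒≈0 (h⁺≈0 x y x≢y)))
    ... | yes ≡.refl = trans (+-cong refl (*-congˡ (reflexive (extend-diagonal (h w) x)))) (trans (+-identityˡ _) (zeroʳ 1#))

  h⁻≐𝟘⇔ : ∀ w → h⁻ w ≐ 𝟘 ⇔ Twisted≈0 (- 1#) w
  h⁻≐𝟘⇔ w = mk⇔ to λ eq x y x≢y → trans (*-congʳ (trans (sym (twist≈ x≢y)) (eq x y))) (zeroˡ _)
    where
    twist≈ : ∀ {x y} (x≢y : x ≢ y) → twist (- 1#) (Residual w) x y ≈ h w x y x≢y - (h w ᵀ) x y x≢y
    twist≈ x≢y = +-cong (reflexive (extend-off (h w) x≢y))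
      (trans (-1*x≈-x _) (-‿cong (reflexive (extend-off (h w) (≢-sym x≢y)))))
    to : h⁻ w ≐ 𝟘 → Twisted≈0 (- 1#) w
    to h⁻≈0 x y with x ≟ᶠ y
    ... | no x≢y = trans (+-congʳ (reflexive (≡.sym (extend-off (h w) x≢y)))) (trans (twist≈ x≢y) (half≈0⇒≈0 (h⁻≈0 x y x≢y)))
    ... | yes ≡.refl = trans (+-cong refl (*-congˡ (reflexive (extend-diagonal (h w) x)))) (trans (+-identityˡ _) (zeroʳ _))

  residual≈0 : ∀ w → Twisted≈0 1# w → Twisted≈0 (- 1#) w → ∀ x y → Residual w x y ≈ 0#
  residual≈0 w sym≈0 asym≈0 x y = *-cancel-0 (⌜suc⌝≉0 1) (begin
    ⌜ 2 ⌝ * A x y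
      ≈⟨ solve 3 (λ e a b → con (+ 2) :* a := (a :+ e :* b) :+ (a :+ :- e :* b)) refl 1# (A x y) (A y x) ⟩
    twist 1# A x y + twist (- 1#) A x y
      ≈⟨ +-cong (sym≈0 x y) (asym≈0 x y) ⟩
    0# + 0#
      ≈⟨ +-identityˡ 0# ⟩
    0# ∎)
    where A = Residual w

  -- A vanishing twist by 1 says that `A` is antisymmetric, one by -1 that `B` is symmetric.
  -- Transposing both grids preserves `inner`, yet changes its sign.
  antisymmetric-⊥-symmetric : ∀ {n} (A B : Grid n) → (∀ x y → twist 1# A x y ≈ 0#) →
                              (∀ x y → twist (- 1#) B x y ≈ 0#) → inner A B ≈ 0#
  antisymmetric-⊥-symmetric A B A≈ B≈ = x≈-x⇒x≈0 (begin
    inner A B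
      ≈⟨ ∑∑-cong (λ x y → begin
           A x y * B x y
             ≈⟨ solve 5 (λ e a a′ b b′ → a :* b :=
                  (a :+ e :* a′) :* b :+ :- e :* a′ :* (b :+ :- e :* b′) :- e :* e :* (a′ :* b′))
                  refl 1# (A x y) (A y x) (B x y) (B y x) ⟩
           twist 1# A x y * B x y + - 1# * A y x * twist (- 1#) B x y - 1# * 1# * (A y x * B y x)
             ≈⟨ +-cong (+-cong (trans (*-congʳ (A≈ x y)) (zeroˡ _)) (trans (*-congˡ (B≈ x y)) (zeroʳ _)))
                       (-‿cong (trans (*-congʳ (*-identityˡ 1#)) (*-identityˡ _))) ⟩
           0# + 0# - A y x * B y x
             ≈⟨ trans (+-congʳ (+-identityˡ 0#)) (+-identityˡ _) ⟩
           - (A y x * B y x) ∎) ⟩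
    sum (λ x → sum (λ y → - (A y x * B y x)))
      ≈⟨ trans (sum-cong-≋ λ x → sum-neg (λ y → A y x * B y x)) (sum-neg (λ x → sum (λ y → A y x * B y x))) ⟩
    - inner (flip A) (flip B)
      ≈⟨ -‿cong (inner-flip A B) ⟩
    - inner A B ∎)

  Δ-additive : (A H : Grid n) (a b : Vector ℝ n) → (∀ {x y} → x ≢ y → A x y ≈ a x + b y + H x y) →
               Δ A ≈ Δ H
  Δ-additive A H a b A≈ = trans
    (+-cong (+-cong (+-cong (A≈ (λ ())) (-‿cong (A≈ (λ ())))) (-‿cong (A≈ (λ ())))) (A≈ (λ ())))
    (lemma (a 0F) (a 1F) (b 2F) (b 3F) (H 0F 2F) (H 1F 2F) (H 0F 3F) (H 1F 3F))
    where
    lemma : ∀ a₀ a₁ b₂ b₃ p q r s → a₀ + b₂ + p - (a₁ + b₂ + q) - (a₀ + b₃ + r) + (a₁ + b₃ + s) ≈ p - q - r + s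
    lemma = solve 8 (λ a₀ a₁ b₂ b₃ p q r s → a₀ :+ b₂ :+ p :- (a₁ :+ b₂ :+ q) :- (a₀ :+ b₃ :+ r) :+ (a₁ :+ b₃ :+ s) :=
      p :- q :- r :+ s) refl

  -- Since `B` vanishes on the diagonal, it is enough that the decomposition of `A` holds off it.
  inner-additive-+ : (A H B : Grid n) (a b : Vector ℝ n) → (∀ {x y} → x ≢ y → A x y ≈ a x + b y + H x y) →
                     (∀ x → B x x ≈ 0#) →
                     inner A B ≈ ∑[ x < n ] (a x * sum (B x)) + ∑[ y < n ] (b y * sum (flip B y)) + inner H B
  inner-additive-+ A H B a b A≈ B≈0 = begin
    inner A B
      ≈⟨ ∑∑-cong term ⟩
    ∑[ x < n ] ∑[ y < n ] ((a x + b y) * B x y + H x y * B x y)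
      ≈⟨ ∑∑-distrib-+ (λ x y → (a x + b y) * B x y) (λ x y → H x y * B x y) ⟩
    inner (λ x y → a x + b y) B + inner H B
      ≈⟨ +-congʳ (inner-additive a b B) ⟩
    ∑[ x < n ] (a x * sum (B x)) + ∑[ y < n ] (b y * sum (flip B y)) + inner H B ∎
    where
    term : ∀ x y → A x y * B x y ≈ (a x + b y) * B x y + H x y * B x y
    term x y with x ≟ᶠ y
    ... | yes ≡.refl = trans (trans (*-congˡ (B≈0 x)) (zeroʳ _)) (sym (trans
            (+-cong (trans (*-congˡ (B≈0 x)) (zeroʳ _)) (trans (*-congˡ (B≈0 x)) (zeroʳ _))) (+-identityˡ 0#)))
    ... | no x≢y = trans (*-congʳ (A≈ x≢y)) (distribʳ _ _ _)

  permuted-≢ : ∀ (π : Permutation′ n) {x y} → x ≢ y → π ⟨$⟩ʳ x ≢ π ⟨$⟩ʳ y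
  permuted-≢ π x≢y eq = x≢y (Injection.injective (↔⇒↣ π) eq)

  -- The additive part of `w` sees only the row and column sums of `u`. The residual of `w` has zero
  -- line sums, so it is blind to the additive part of `u`.
  inner-residual : ∀ π (w u : Weight n) → Centered w → Centered u →
                   inner (permute π (extend w)) (extend u) ≈
                   ∑[ x < n ] M w u (π ⟨$⟩ʳ x) x + inner (permute π (Residual w)) (Residual u)
  inner-residual π w u w-centered u-centered = begin
    inner (permute π (extend w)) (extend u)
      ≈⟨ inner-additive-+ (permute π (extend w)) (permute π H) (extend u) (a w ∘ (π ⟨$⟩ʳ_)) (b w ∘ (π ⟨$⟩ʳ_))
           (λ x≢y → decomposition w (permuted-≢ π x≢y)) (λ x → reflexive (extend-diagonal u x)) ⟩
    ∑[ x < n ] (a w (π ⟨$⟩ʳ x) * r u x) + ∑[ x < n ] (b w (π ⟨$⟩ʳ x) * c u x) + inner (permute π H) (extend u)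
      ≈⟨ +-cong (sym (∑-distrib-+ (λ x → a w (π ⟨$⟩ʳ x) * r u x) (λ x → b w (π ⟨$⟩ʳ x) * c u x)))
                residual-part ⟩
    ∑[ x < n ] (a w (π ⟨$⟩ʳ x) * r u x + b w (π ⟨$⟩ʳ x) * c u x) + inner (permute π H) (Residual u)
      ≈⟨ +-congʳ (sum-cong-≋ λ x → marginal-part (π ⟨$⟩ʳ x) x) ⟩
    ∑[ x < n ] M w u (π ⟨$⟩ʳ x) x + inner (permute π H) (Residual u) ∎
    where
    H = Residual w
    permuted-rows : ∀ x → sum (permute π H x) ≈ 0#
    permuted-rows x = trans (sym (sum-permute (H (π ⟨$⟩ʳ x)) π)) (residual-rows w w-centered (π ⟨$⟩ʳ x))
    permuted-columns : ∀ y → sum (flip (permute π H) y) ≈ 0#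
    permuted-columns y = trans (sym (sum-permute (flip H (π ⟨$⟩ʳ y)) π)) (residual-columns w w-centered (π ⟨$⟩ʳ y))

    residual-part : inner (permute π H) (extend u) ≈ inner (permute π H) (Residual u)
    residual-part = begin
      inner (permute π H) (extend u)
        ≈⟨ inner-comm (permute π H) (extend u) ⟩
      inner (extend u) (permute π H)
        ≈⟨ inner-additive-+ (extend u) (Residual u) (permute π H) (a u) (b u)
             (decomposition u) (λ x → residual-diagonal w w-centered (π ⟨$⟩ʳ x)) ⟩
      ∑[ x < n ] (a u x * sum (permute π H x)) + ∑[ y < n ] (b u y * sum (flip (permute π H) y)) +
      inner (Residual u) (permute π H)
        ≈⟨ +-congʳ (trans (+-cong
             (sum≈0 _ λ x → trans (*-congˡ (permuted-rows x)) (zeroʳ (a u x)))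
             (sum≈0 _ λ y → trans (*-congˡ (permuted-columns y)) (zeroʳ (b u y)))) (+-identityˡ 0#)) ⟩
      0# + inner (Residual u) (permute π H)
        ≈⟨ trans (+-identityˡ _) (inner-comm (Residual u) (permute π H)) ⟩
      inner (permute π H) (Residual u) ∎

    -- In `(p+q)((N-2)p′+Nq′) + (p-q)((N-2)p′-Nq′)` the cross terms cancel; the remaining
    -- coefficients `2(N-2)` and `2N` are the squares of the scalings in `α` and `β`.
    marginal-part : ∀ x y → a w x * r u y + b w x * c u y ≈ M w u x y
    marginal-part x y = begin
      a w x * r u y + b w x * c u y
        ≈⟨ +-cong (*-congˡ (r≈ u y)) (*-congˡ (c≈ u y)) ⟩
      a w x * ((N - ⌜ 2 ⌝) * p u y + N * q u y) + b w x * ((N - ⌜ 2 ⌝) * p u y - N * q u y)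
        ≈⟨ solve 5 (λ n p q p′ q′ → (p :+ q) :* ((n :- con (+ 2)) :* p′ :+ n :* q′) :+ (p :- q) :* ((n :- con (+ 2)) :* p′ :- n :* q′) :=
             con (+ 2) :* (n :- con (+ 2)) :* (p :* p′) :+ con (+ 2) :* n :* (q :* q′)) refl N (p w x) (q w x) (p u y) (q u y) ⟩
      ⌜ 2 ⌝ * (N - ⌜ 2 ⌝) * (p w x * p u y) + ⌜ 2 ⌝ * N * (q w x * q u y)
        ≈⟨ +-cong (*-congʳ (√-square 0≤2[N-2])) (*-congʳ (√-square 0≤2N)) ⟨
      √ (⌜ 2 ⌝ * (N - ⌜ 2 ⌝)) * √ (⌜ 2 ⌝ * (N - ⌜ 2 ⌝)) * (p w x * p u y) + √ (⌜ 2 ⌝ * N) * √ (⌜ 2 ⌝ * N) * (q w x * q u y)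
        ≈⟨ +-cong (regroup (√ (⌜ 2 ⌝ * (N - ⌜ 2 ⌝))) (p w x) (p u y)) (regroup (√ (⌜ 2 ⌝ * N)) (q w x) (q u y)) ⟩
      M w u x y ∎
      where
      regroup : ∀ s x y → s * s * (x * y) ≈ s * x * (s * y)
      regroup = solve 3 (λ s x y → s :* s :* (x :* y) := s :* x :* (s :* y)) refl

  Conditions : Weight n → Weight n → Set ℓ
  Conditions w u = (Twisted≈0 1# w ⊎ Twisted≈0 1# u) × (Twisted≈0 (- 1#) w ⊎ Twisted≈0 (- 1#) u)

  -- In each case either one residual is zero, or one is antisymmetric and the other symmetric;
  -- relabelling preserves both symmetries.
  residuals-orthogonal : ∀ w u → Conditions w u → Orthogonal (Residual w) (Residual u)
  residuals-orthogonal w u (inj₁ w⁺ , inj₁ w⁻) π =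
    inner-zeroˡ (permute π (Residual w)) (Residual u) λ x y → residual≈0 w w⁺ w⁻ (π ⟨$⟩ʳ x) (π ⟨$⟩ʳ y)
  residuals-orthogonal w u (inj₁ w⁺ , inj₂ u⁻) π =
    antisymmetric-⊥-symmetric (permute π (Residual w)) (Residual u) (λ x y → w⁺ (π ⟨$⟩ʳ x) (π ⟨$⟩ʳ y)) u⁻
  residuals-orthogonal w u (inj₂ u⁺ , inj₁ w⁻) π =
    trans (inner-comm (permute π (Residual w)) (Residual u))
      (antisymmetric-⊥-symmetric (Residual u) (permute π (Residual w)) u⁺ (λ x y → w⁻ (π ⟨$⟩ʳ x) (π ⟨$⟩ʳ y)))
  residuals-orthogonal w u (inj₂ u⁺ , inj₂ u⁻) π =
    trans (inner-comm (permute π (Residual w)) (Residual u))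
      (inner-zeroˡ (Residual u) (permute π (Residual w)) (residual≈0 u u⁺ u⁻))

  module _ (s : ℝ) (s≈±1 : s ≈ 1# ⊎ s ≈ - 1#) where

    -- Twisting an additive function gives an additive function again, with `a + s b` in the first
    -- variable and `b + s a` in the second, and `Δ` kills it.
    Δ-twist-residual : ∀ w (π : Permutation′ n) → Δ (permute π (twist s (extend w))) ≈ Δ (permute π (twist s (Residual w)))
    Δ-twist-residual w π = Δ-additive _ _ (λ x → a w (π ⟨$⟩ʳ x) + s * b w (π ⟨$⟩ʳ x)) (λ y → b w (π ⟨$⟩ʳ y) + s * a w (π ⟨$⟩ʳ y))
      λ {x} {y} x≢y → trans
        (+-cong (decomposition w (permuted-≢ π x≢y)) (*-congˡ (decomposition w (permuted-≢ π (≢-sym x≢y)))))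
        (lemma s (a w (π ⟨$⟩ʳ x)) (b w (π ⟨$⟩ʳ x)) (a w (π ⟨$⟩ʳ y)) (b w (π ⟨$⟩ʳ y)) _ _)
      where
      lemma : ∀ s a b a′ b′ h h′ → a + b′ + h + s * (a′ + b + h′) ≈ a + s * b + (b′ + s * a′) + (h + s * h′)
      lemma = solve 7 (λ s a b a′ b′ h h′ → a :+ b′ :+ h :+ s :* (a′ :+ b :+ h′) :=
                         a :+ s :* b :+ (b′ :+ s :* a′) :+ (h :+ s :* h′)) refl

    Δ≈0⇒twisted≈0 : ∀ w → Centered w → (∀ (π : Permutation′ n) → Δ (permute π (twist s (extend w))) ≈ 0#) → Twisted≈0 s w
    Δ≈0⇒twisted≈0 w centered Δ≈0 = Δ≈0⇒≈0 {S = twist s (Residual w)}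
      (λ x → trans (+-cong (residual-diagonal w centered x) (trans (*-congˡ (residual-diagonal w centered x)) (zeroʳ s))) (+-identityˡ 0#))
      (λ x → sum-twist (Residual w x) (flip (Residual w) x) (residual-rows w centered x) (residual-columns w centered x))
      (λ y → sum-twist (flip (Residual w) y) (Residual w y) (residual-columns w centered y) (residual-rows w centered y))
      (λ π → trans (sym (Δ-twist-residual w π)) (Δ≈0 π))
      s (±-numeral≉0 s s≈±1)
      (λ x y → begin
        Residual w y x + s * Residual w x y
          ≈⟨ +-congʳ (trans (*-congʳ (±-square s s≈±1)) (*-identityˡ _)) ⟨
        s * s * Residual w y x + s * Residual w x y
          ≈⟨ solve 3 (λ s a b → s :* s :* b :+ s :* a := s :* (a :+ s :* b)) refl s (Residual w x y) (Residual w y x) ⟩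
        s * twist s (Residual w) x y ∎)
      where
      sum-twist : (f g : Vector ℝ n) → sum f ≈ 0# → sum g ≈ 0# → sum (λ x → f x + s * g x) ≈ 0#
      sum-twist f g Σf≈0 Σg≈0 = trans (∑-distrib-+ f (λ x → s * g x))
        (trans (+-cong Σf≈0 (trans (sum-*ˡ s g) (trans (*-congˡ Σg≈0) (zeroʳ s)))) (+-identityˡ 0#))

    -- If some mixed difference of `u` were nonzero, it could be cancelled from its products with
    -- all those of `w`, and the twisted residual of `w` would vanish.
    orthogonal⇒twisted≈0 : ∀ w u → Centered w → Centered u → Orthogonal (extend w) (extend u) →
                           ¬ Twisted≈0 s w → Twisted≈0 s u
    orthogonal⇒twisted≈0 w u w-centered u-centered w⊥u w≉0 =
      Δ≈0⇒twisted≈0 u u-centered λ σ → stable λ Δu≉0 →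
        w≉0 (Δ≈0⇒twisted≈0 w w-centered λ π → *-cancel-0 Δu≉0 (trans (*-comm _ _)
          -- `twist s (permute π A)` and `permute π (twist s A)` agree definitionally.
          (Δ-twist-orthogonal s {permute π (extend w)} {permute σ (extend u)} (±-square s s≈±1)
            (Orthogonal-permute {A = extend w} {extend u} π σ w⊥u))))

  orthogonal⇒M≈0 : ∀ w u → Centered w → Centered u → Orthogonal (extend w) (extend u) →
                   Orthogonal (Residual w) (Residual u) → ∀ x y → M w u x y ≈ 0#
  orthogonal⇒M≈0 w u w-centered u-centered w⊥u residuals-⊥ = transversals≈0⇒≈0 (M w u)
    (λ x → trans (∑-distrib-+ (λ y → α w x * α u y) (λ y → β w x * β u y))
      (trans (+-cong (scaled≈0 (α u) (sum-α≈0 u u-centered)) (scaled≈0 (β u) (sum-β≈0 u u-centered))) (+-identityˡ 0#)))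
    (λ y → trans (∑-distrib-+ (λ x → α w x * α u y) (λ x → β w x * β u y))
      (trans (+-cong (scaledʳ≈0 (α w) (sum-α≈0 w w-centered)) (scaledʳ≈0 (β w) (sum-β≈0 w w-centered))) (+-identityˡ 0#)))
    λ π → trans (sym (trans (+-congˡ (residuals-⊥ π)) (+-identityʳ _)))
      (trans (sym (inner-residual π w u w-centered u-centered)) (w⊥u π))
    where
    scaled≈0 : ∀ {k} (f : Vector ℝ n) → sum f ≈ 0# → sum (λ x → k * f x) ≈ 0#
    scaled≈0 {k} f Σf≈0 = trans (sum-*ˡ k f) (trans (*-congˡ Σf≈0) (zeroʳ k))
    scaledʳ≈0 : ∀ {k} (f : Vector ℝ n) → sum f ≈ 0# → sum (λ x → f x * k) ≈ 0#
    scaledʳ≈0 {k} f Σf≈0 = trans (sum-*ʳ k f) (trans (*-congʳ Σf≈0) (zeroˡ k))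
    sum-α≈0 : ∀ w → Centered w → sum (α w) ≈ 0#
    sum-α≈0 w centered = scaled≈0 (p w) (sum-p≈0 w centered)
    sum-β≈0 : ∀ w → Centered w → sum (β w) ≈ 0#
    sum-β≈0 w centered = scaled≈0 (q w) (sum-q≈0 w centered)

  conditions : ∀ w u → h⁺ w ≐ 𝟘 ⊎ h⁺ u ≐ 𝟘 → h⁻ w ≐ 𝟘 ⊎ h⁻ u ≐ 𝟘 → Conditions w u
  conditions w u h⁺≈0 h⁻≈0 =
    Sum.map (Equivalence.to (h⁺≐𝟘⇔ w)) (Equivalence.to (h⁺≐𝟘⇔ u)) h⁺≈0 ,
    Sum.map (Equivalence.to (h⁻≐𝟘⇔ w)) (Equivalence.to (h⁻≐𝟘⇔ u)) h⁻≈0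

  disc≈0⇔ : ∀ w u → Centered w → Centered u →
    disc w u ≈ 0# ⇔ ((h⁺ w ≐ 𝟘 ⊎ h⁺ u ≐ 𝟘) × (h⁻ w ≐ 𝟘 ⊎ h⁻ u ≐ 𝟘) × trace (Γ w ⊗ Γ u) ≈ 0#)
  disc≈0⇔ w u w-centered u-centered = mk⇔ to from
    where
    from : (h⁺ w ≐ 𝟘 ⊎ h⁺ u ≐ 𝟘) × (h⁻ w ≐ 𝟘 ⊎ h⁻ u ≐ 𝟘) × trace (Γ w ⊗ Γ u) ≈ 0# → disc w u ≈ 0#
    from (h⁺≈0 , h⁻≈0 , trace≈0) = Equivalence.from (disc≈0⇔orthogonal w u w-centered) λ π →
      trans (inner-residual π w u w-centered u-centered) (trans
        (+-cong (sum≈0 _ λ x → trace≈0⇒M≈0 w u trace≈0 (π ⟨$⟩ʳ x) x)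
          (residuals-orthogonal w u (conditions w u h⁺≈0 h⁻≈0) π))
        (+-identityˡ 0#))
    to : disc w u ≈ 0# → (h⁺ w ≐ 𝟘 ⊎ h⁺ u ≐ 𝟘) × (h⁻ w ≐ 𝟘 ⊎ h⁻ u ≐ 𝟘) × trace (Γ w ⊗ Γ u) ≈ 0#
    to disc≈0 = h⁺≈0 , h⁻≈0 , M≈0⇒trace≈0 w u (orthogonal⇒M≈0 w u w-centered u-centered w⊥u
                                                (residuals-orthogonal w u (conditions w u h⁺≈0 h⁻≈0)))
      where
      w⊥u : Orthogonal (extend w) (extend u)
      w⊥u = Equivalence.to (disc≈0⇔orthogonal w u w-centered) disc≈0
      h⁺≈0 : h⁺ w ≐ 𝟘 ⊎ h⁺ u ≐ 𝟘
      h⁺≈0 = decide (h⁺ w ≐? 𝟘) λ w≉0 → Equivalence.from (h⁺≐𝟘⇔ u)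
        (orthogonal⇒twisted≈0 1# (inj₁ refl) w u w-centered u-centered w⊥u (w≉0 ∘ Equivalence.from (h⁺≐𝟘⇔ w)))
      h⁻≈0 : h⁻ w ≐ 𝟘 ⊎ h⁻ u ≐ 𝟘
      h⁻≈0 = decide (h⁻ w ≐? 𝟘) λ w≉0 → Equivalence.from (h⁻≐𝟘⇔ u)
        (orthogonal⇒twisted≈0 (- 1#) (inj₂ refl) w u w-centered u-centered w⊥u (w≉0 ∘ Equivalence.from (h⁻≐𝟘⇔ w)))

-- Ranks and counts along a list

module ListSums where
  private variable
    ℓ ℓ′ : Level
    A : Set ℓ

  sum-map-+ : ∀ (f g : A → ℕ) xs → ℕ.sum (map (λ x → f x ℕ.+ g x) xs) ≡ ℕ.sum (map f xs) ℕ.+ ℕ.sum (map g xs)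
  sum-map-+ f g List.[]       = ≡.refl
  sum-map-+ f g (x List.∷ xs) = ≡.trans (≡.cong (f x ℕ.+ g x ℕ.+_) (sum-map-+ f g xs)) (interchange (f x) (g x) _ _)
    where open Algebra.Properties.CommutativeSemigroup ℕ.+-commutativeSemigroup using (interchange)

  length≤sum : (f : A → ℕ) {xs : List A} → All (λ x → 1 ℕ.≤ f x) xs → length xs ℕ.≤ ℕ.sum (map f xs)
  length≤sum f All.[]         = z≤n
  length≤sum f (1≤fx All.∷ ps) = ℕ.+-mono-≤ 1≤fx (length≤sum f ps)

module OrthogonalRanks {ℓ : Level} (R : RealNumbers ℓ) where
  open Weights R
  open OrderedField R
  open Sums R
  open Gram R
  open ListSums
  open Relation.Binary.Reasoning.Setoid setoid

  private variable
    k k′ n : ℕ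

  module _ {a p : Level} {A : Set a} {P : A → Set p} (P? : ∀ x → Dec (P x)) where

    private
      count : List A → ℕ
      count xs = ℕ.sum (map (λ x → 𝟙 (¬? (P? x))) xs)

    count≡0 : ∀ {xs} → All P xs → count xs ≡ 0
    count≡0 All.[] = ≡.refl
    count≡0 {x List.∷ _} (px All.∷ pxs) with P? x
    ... | yes _  = count≡0 pxs
    ... | no ¬px = ⊥-elim (¬px px)

    -- If `P` fails at the head, every disjunction with the head forces `P` on the other element, so
    -- the tail counts nothing.
    count≤1 : ∀ {xs} → AllPairs (λ x y → P x ⊎ P y) xs → count xs ℕ.≤ 1
    count≤1 AllPairs.[] = z≤n
    count≤1 {x List.∷ _} (ps AllPairs.∷ pss) with P? x
    ... | yes _  = count≤1 pss
    ... | no ¬px = s≤s (ℕ.≤-reflexive (count≡0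
      (All.map (λ { (inj₁ px) → ⊥-elim (¬px px) ; (inj₂ py) → py }) ps)))

  positive : ∀ {p q} {P : Set p} {Q : Set q} (P? : Dec P) (Q? : Dec Q) → (P → Q → k ≢ 0) →
             1 ℕ.≤ k ℕ.+ 𝟙 (¬? P?) ℕ.+ 𝟙 (¬? Q?)
  positive {zero}  (yes p) (yes q) k≢0 = ⊥-elim (k≢0 p q ≡.refl)
  positive {zero}  (yes p) (no ¬q) k≢0 = s≤s z≤n
  positive {zero}  (no ¬p) Q?      k≢0 = s≤s z≤n
  positive {suc k} P?      Q?      k≢0 = s≤s z≤n

  dimension-0 : ∀ {m} {V : Pred (Vector ℝ m) ℓ} → HasDimension V k → k ≡ 0 → ∀ {v} → v ∈ V → ∀ i → v i ≈ 0#
  dimension-0 V-dim ≡.refl v∈V = proj₂ (HasDimension.spanning V-dim v∈V)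

  -- The first three vectors satisfy x₀ det(x₁,x₂) + x₁ det(x₂,x₀) + x₂ det(x₀,x₁) = 0,
  -- so det(x₀,x₁) = 0, which makes x₀ and x₁ dependent.
  independent⇒≤2 : (b : Vector (Vector ℝ 2) k) → LinearlyIndependent b → k ℕ.≤ 2
  independent⇒≤2 {0} b _ = z≤n
  independent⇒≤2 {1} b _ = s≤s z≤n
  independent⇒≤2 {2} b _ = s≤s (s≤s z≤n)
  independent⇒≤2 {suc (suc (suc k))} b independent = ⊥-elim (1≉0 (relation 1# 0# 0#
      (λ i → trans (+-cong (trans (*-identityˡ _) (x₀≈0 i)) (+-cong (zeroˡ _) (zeroˡ _)))
                   (trans (+-identityˡ _) (+-identityˡ _))) 0F))
    where
    x y z : Vector ℝ 2
    x = b 0F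
    y = b 1F
    z = b 2F
    relation : ∀ c d e → (∀ i → c * x i + (d * y i + e * z i) ≈ 0#) → ∀ j → (c ∷ d ∷ e ∷ λ _ → 0#) j ≈ 0#
    relation c d e eq = independent (c ∷ d ∷ e ∷ λ _ → 0#) λ i → trans
      (+-congˡ (+-congˡ (trans (+-congˡ (sum≈0 _ λ j → zeroˡ (b (suc (suc (suc j))) i))) (+-identityʳ _)))) (eq i)
    det : Vector ℝ 2 → Vector ℝ 2 → ℝ
    det u v = u 0F * v 1F - u 1F * v 0F
    det≈0 : det x y ≈ 0#
    det≈0 = relation (det y z) (det z x) (det x y) (λ
      { 0F → solve 6 (λ x₀ x₁ y₀ y₁ z₀ z₁ →
          (y₀ :* z₁ :- y₁ :* z₀) :* x₀ :+ ((z₀ :* x₁ :- z₁ :* x₀) :* y₀ :+ (x₀ :* y₁ :- x₁ :* y₀) :* z₀) :=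
          con (+ 0)) refl (x 0F) (x 1F) (y 0F) (y 1F) (z 0F) (z 1F)
      ; 1F → solve 6 (λ x₀ x₁ y₀ y₁ z₀ z₁ →
          (y₀ :* z₁ :- y₁ :* z₀) :* x₁ :+ ((z₀ :* x₁ :- z₁ :* x₀) :* y₁ :+ (x₀ :* y₁ :- x₁ :* y₀) :* z₁) :=
          con (+ 0)) refl (x 0F) (x 1F) (y 0F) (y 1F) (z 0F) (z 1F) }) 2F
    -- The combination `y_l x - x_l y` is zero, and by independence so is its coefficient `- x_l`.
    vanishing : ∀ l → (∀ i → y l * x i - x l * y i ≈ 0#) → x l ≈ 0#
    vanishing l eq = trans (sym (-‿involutive _)) (trans (-‿cong (relation (y l) (- x l) 0#
      (λ i → trans (solve 5 (λ a b c d e → a :* b :+ (:- c :* d :+ con (+ 0) :* e) := a :* b :- c :* d)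
               refl (y l) (x i) (x l) (y i) (z i)) (eq i)) 1F)) -0#≈0#)
    x₀≈0 : ∀ i → x i ≈ 0#
    x₀≈0 0F = vanishing 0F λ
      { 0F → solve 2 (λ a b → a :* b :- b :* a := con (+ 0)) refl (y 0F) (x 0F)
      ; 1F → trans (solve 4 (λ x₀ x₁ y₀ y₁ → y₀ :* x₁ :- x₀ :* y₁ := :- (x₀ :* y₁ :- x₁ :* y₀))
               refl (x 0F) (x 1F) (y 0F) (y 1F)) (trans (-‿cong det≈0) -0#≈0#) }
    x₀≈0 1F = vanishing 1F λ
      { 0F → trans (solve 4 (λ x₀ x₁ y₀ y₁ → y₁ :* x₀ :- x₁ :* y₀ := x₀ :* y₁ :- x₁ :* y₀)
               refl (x 0F) (x 1F) (y 0F) (y 1F)) det≈0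
      ; 1F → solve 2 (λ a b → a :* b :- b :* a := con (+ 0)) refl (y 1F) (x 1F) }

  ++-all : ∀ {a p} {A : Set a} (P : A → Set p) (xs : Vector A k) (ys : Vector A k′) →
           (∀ i → P (xs i)) → (∀ j → P (ys j)) → ∀ l → P ((xs ++ ys) l)
  ++-all {k = k} P xs ys Pxs Pys l with splitAt k l
  ... | inj₁ i = Pxs i
  ... | inj₂ j = Pys j

  linearCombination-++ : (c : Vector ℝ (k ℕ.+ k′)) (b : Vector (Vector ℝ n) k) (b′ : Vector (Vector ℝ n) k′) →
    ∀ i → linearCombination c (b ++ b′) i ≈
          linearCombination (λ j → c (j ↑ˡ k′)) b i + linearCombination (λ j → c (k ↑ʳ j)) b′ i
  linearCombination-++ {k} {k′} c b b′ i = trans (sum-+ k (λ j → c j * (b ++ b′) j i)) (+-cong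
    (sum-cong-≋ λ j → *-congˡ (reflexive (≡.cong (λ v → v i) (lookup-++ˡ b b′ j))))
    (sum-cong-≋ λ j → *-congˡ (reflexive (≡.cong (λ v → v i) (lookup-++ʳ b b′ j)))))

  -- A vanishing combination splits as `v + v′ = 0` with `v` orthogonal to `v′`; then
  -- `dot v v = dot v (v + v′) = 0`, so both parts vanish separately.
  ++-independent : {b : Vector (Vector ℝ n) k} {b′ : Vector (Vector ℝ n) k′} →
    LinearlyIndependent b → LinearlyIndependent b′ → (∀ i j → dot (b i) (b′ j) ≈ 0#) →
    LinearlyIndependent (b ++ b′)
  ++-independent {n} {k} {k′} {b} {b′} b-indep b′-indep b⊥b′ c eq l =
    ≡.subst (λ l → c l ≈ 0#) (join-splitAt k k′ l) (helper (splitAt k l))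
    where
    v v′ : Vector ℝ n
    v  = linearCombination (λ j → c (j ↑ˡ k′)) b
    v′ = linearCombination (λ j → c (k ↑ʳ j)) b′
    v+v′≈0 : ∀ i → v i + v′ i ≈ 0#
    v+v′≈0 i = trans (sym (linearCombination-++ c b b′ i)) (eq i)
    v⊥v′ : dot v v′ ≈ 0#
    v⊥v′ = Span-⊥-Span {b = b} {b′} b⊥b′ {v} {v′} (_ , λ _ → refl) (_ , λ _ → refl)
    v≈0 : ∀ i → v i ≈ 0#
    v≈0 = dot≈0⇒≈0 v (begin
      dot v v                            ≈⟨ +-identityʳ _ ⟨
      dot v v + 0#                       ≈⟨ +-congˡ v⊥v′ ⟨
      dot v v + dot v v′                 ≈⟨ ∑-distrib-+ (λ i → v i * v i) (λ i → v i * v′ i) ⟨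
      sum (λ i → v i * v i + v i * v′ i) ≈⟨ sum≈0 _ (λ i → trans (sym (distribˡ (v i) (v i) (v′ i)))
                                              (trans (*-congˡ (v+v′≈0 i)) (zeroʳ (v i)))) ⟩
      0#                                 ∎)
    v′≈0 : ∀ i → v′ i ≈ 0#
    v′≈0 i = trans (sym (+-identityˡ _)) (trans (+-congʳ (sym (v≈0 i))) (v+v′≈0 i))
    helper : ∀ s → c (join k k′ s) ≈ 0#
    helper (inj₁ i) = b-indep _ v≈0 i
    helper (inj₂ j) = b′-indep _ v′≈0 j

  Columns-⊥ : Weight n → Weight n → Set ℓ
  Columns-⊥ w u = ∀ i j → dot (Γ-column w i) (Γ-column u j) ≈ 0#

  -- The induction carries an independent family `b` orthogonal to all columns still to come. Each
  -- step appends a basis of the next column space, as long as the rank, and at the end the length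
  -- of `b` is bounded by the dimension of the plane.
  sum-ranks≤2 : {ws : List (Weight n)} (b : Vector (Vector ℝ 2) k) → LinearlyIndependent b →
                All (λ w → ∀ j i → dot (b j) (Γ-column w i) ≈ 0#) ws → AllPairs Columns-⊥ ws →
                k ℕ.+ ℕ.sum (map (λ w → rank (Γ w)) ws) ℕ.≤ 2
  sum-ranks≤2 {k = k} b independent All.[] AllPairs.[] =
    ≡.subst (ℕ._≤ 2) (≡.sym (ℕ.+-identityʳ k)) (independent⇒≤2 b independent)
  sum-ranks≤2 {k = k} {w List.∷ ws} b independent (b⊥w All.∷ b⊥ws) (w⊥ws AllPairs.∷ ws-⊥) =
    ≡.subst (ℕ._≤ 2) (ℕ.+-assoc k (rank (Γ w)) _)
      (sum-ranks≤2 (b ++ b′) (++-independent independent b′-independent λ i j → ⊥-Span (b i) (Γ-column w) (b⊥w i) {b′ j} (b′∈ j))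
        (All.zipWith (λ {u} (b⊥u , w⊥u) → ++-all (λ v → ∀ i → dot v (Γ-column u i) ≈ 0#) b b′ b⊥u
           λ j i → trans (dot-comm (b′ j) (Γ-column u i))
             (⊥-Span (Γ-column u i) (Γ-column w) (λ l → trans (dot-comm (Γ-column u i) (Γ-column w l)) (w⊥u l i)) {b′ j} (b′∈ j)))
          (b⊥ws , w⊥ws)) ws-⊥)
    where
    open HasDimension (proj₂ (dimension (Γ-column w)))
      renaming (basis to b′; basis∈ to b′∈; independent to b′-independent) hiding (spanning)

-- Bounds for pairwise zero-discrepant families

module FamilyBounds {ℓ : Level} (R : RealNumbers ℓ) {m : ℕ} where
  open Weights R
  open OrderedField R
  open Gram R
  open Discrepancy R
  open Decomposition R {m}
  open Characterisation R {m}
  open OrthogonalRanks R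
  open ListSums

  -- Rank 0 makes `Γ w` zero. Its diagonal entries are the squared norms of `α w` and `β w`, so `p`
  -- and `q` vanish along with the residual. Thus a nonzero weight contributes at least 1 to the
  -- sum, which bounds the cardinality.
  rank≡0⇒≈𝟘 : ∀ w → h⁺ w ≐ 𝟘 → h⁻ w ≐ 𝟘 → rank (Γ w) ≡ 0 → w ≐ 𝟘
  rank≡0⇒≈𝟘 w h⁺≈0 h⁻≈0 rank≡0 x y x≢y =
    trans (reflexive (≡.sym (extend-off w x≢y))) (trans (decomposition w x≢y) (trans
      (+-cong (trans (+-cong (trans (+-cong (p≈0 x) (q≈0 x)) (+-identityˡ 0#))
                             (trans (+-cong (p≈0 y) (-‿cong (q≈0 y))) (-‿inverseʳ 0#)))
                     (+-identityˡ 0#))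
              (residual≈0 w (Equivalence.to (h⁺≐𝟘⇔ w) h⁺≈0) (Equivalence.to (h⁻≐𝟘⇔ w) h⁻≈0) x y))
      (+-identityˡ 0#)))
    where
    columns≈0 : ∀ i j → Γ-column w j i ≈ 0#
    columns≈0 i j = dimension-0 (proj₂ (dimension (Γ-column w))) rank≡0 (basis∈Span (Γ-column w) j) i
    p≈0 : ∀ x → p w x ≈ 0#
    p≈0 x = *-cancel-0 (√≉0 0≤2[N-2] 2[N-2]≉0) (dot≈0⇒≈0 (α w) (columns≈0 0F 0F) x)
    q≈0 : ∀ x → q w x ≈ 0#
    q≈0 x = *-cancel-0 (√≉0 0≤2N 2N≉0) (dot≈0⇒≈0 (β w) (columns≈0 1F 1F) x)

  module _ {p : Level} (F : Pred (Weight n) p) (F-weights : ∀ {w} → w ∈ F → ¬ (w ≐ 𝟘) × Centered w)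
           (F-discrepancy : PairwiseZeroDiscrepant F) where
    open Families _≐_ F

    Separated : Weight n → Weight n → Set ℓ
    Separated w u = (h⁺ w ≐ 𝟘 ⊎ h⁺ u ≐ 𝟘) × (h⁻ w ≐ 𝟘 ⊎ h⁻ u ≐ 𝟘) × trace (Γ w ⊗ Γ u) ≈ 0#

    separated : ∀ {ws} → FiniteSubset ws → AllPairs Separated ws
    separated {List.[]} (All.[] , AllPairs.[]) = AllPairs.[]
    separated {w List.∷ _} (w∈F All.∷ ws∈F , w≉ws AllPairs.∷ ws≉) =
      All.zipWith (λ {u} (u∈F , w≉u) → Equivalence.to
        (disc≈0⇔ w u (proj₂ (F-weights w∈F)) (proj₂ (F-weights u∈F))) (F-discrepancy w∈F u∈F w≉u)) (ws∈F , w≉ws)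
      AllPairs.∷ separated (ws∈F , ws≉)

    -- The bound is `2 + 1 + 1`: the ranks fit into the plane, and conditions (i) and (ii) each
    -- leave at most one member with nonzero `h⁺` and at most one with nonzero `h⁻`.
    weight-sum≤4 : Sum≤ (λ w → rank (Γ w) ℕ.+ 𝟙 (¬? (h⁺ w ≐? 𝟘)) ℕ.+ 𝟙 (¬? (h⁻ w ≐? 𝟘))) 4
    weight-sum≤4 ws ws⊆F = ≡.subst (ℕ._≤ 4) (≡.sym sums)
      (ℕ.+-mono-≤ (ℕ.+-mono-≤
        (sum-ranks≤2 [] (λ _ _ ()) (All.universal (λ _ ()) ws)
          (AllPairs.map (λ {w} {u} (_ , _ , tr≈0) → trace≈0⇒columns-⊥ w u tr≈0) pairs))
        (count≤1 (λ w → h⁺ w ≐? 𝟘) (AllPairs.map proj₁ pairs)))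
        (count≤1 (λ w → h⁻ w ≐? 𝟘) (AllPairs.map (proj₁ ∘ proj₂) pairs)))
      where
      pairs = separated ws⊆F
      k k⁺ k⁻ : Weight n → ℕ
      k  w = rank (Γ w)
      k⁺ w = 𝟙 (¬? (h⁺ w ≐? 𝟘))
      k⁻ w = 𝟙 (¬? (h⁻ w ≐? 𝟘))
      sums : ℕ.sum (map (λ w → k w ℕ.+ k⁺ w ℕ.+ k⁻ w) ws) ≡
             ℕ.sum (map k ws) ℕ.+ ℕ.sum (map k⁺ ws) ℕ.+ ℕ.sum (map k⁻ ws)
      sums = ≡.trans (sum-map-+ (λ w → k w ℕ.+ k⁺ w) k⁻ ws) (≡.cong (ℕ._+ ℕ.sum (map k⁻ ws)) (sum-map-+ k k⁺ ws))

    cardinality≤4 : Cardinality≤ 4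
    cardinality≤4 ws ws⊆F = ℕ.≤-trans
      (length≤sum (λ w → rank (Γ w) ℕ.+ 𝟙 (¬? (h⁺ w ≐? 𝟘)) ℕ.+ 𝟙 (¬? (h⁻ w ≐? 𝟘)))
        (All.map (λ {w} w∈F → positive (h⁺ w ≐? 𝟘) (h⁻ w ≐? 𝟘)
          λ h⁺≈0 h⁻≈0 rank≡0 → proj₁ (F-weights w∈F) (rank≡0⇒≈𝟘 w h⁺≈0 h⁻≈0 rank≡0)) (proj₁ ws⊆F)))
      (weight-sum≤4 ws ws⊆F)

theorem6p2 : ∀ {ℓ ℓ′} (R : RealNumbers ℓ) → let open Weights R in (n : ℕ) → 4 ℕ.≤ n →
    ((w u : Weight n) → Centered w → Centered u →
    (disc w u ≈ 0# ⇔ ((h⁺ w ≐ 𝟘 ⊎ h⁺ u ≐ 𝟘) × (h⁻ w ≐ 𝟘 ⊎ h⁻ u ≐ 𝟘) × trace (Γ w ⊗ Γ u) ≈ 0#))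
    × (trace (Γ w ⊗ Γ u) ≈ 0# ⇔ columnSpace (Γ w) ⊥ₛ columnSpace (Γ u)))
    × ((F : Pred (Weight n) ℓ′) → (∀ {w} → w ∈ F → ¬ (w ≐ 𝟘) × Centered w) → PairwiseZeroDiscrepant F →
    let open Families _≐_ F in
    Sum≤ (λ w → rank (Γ w) ℕ.+ 𝟙 (¬? (h⁺ w ≐? 𝟘)) ℕ.+ 𝟙 (¬? (h⁻ w ≐? 𝟘))) 4 × Cardinality≤ 4)
-- Matching on `4 ≤ n` turns `n` into `4 + m`, so that the points `0F` to `3F` exist and
-- transpositions of them compute.
theorem6p2 R _ (s≤s (s≤s (s≤s (s≤s (z≤n {m}))))) =
  (λ w u w-centered u-centered → disc≈0⇔ w u w-centered u-centered , trace≈0⇔⊥ w u) ,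
  (λ F F-weights F-discrepancy →
    weight-sum≤4 F F-weights F-discrepancy , cardinality≤4 F F-weights F-discrepancy)
  where
  open Gram R using (trace≈0⇔⊥)
  open Characterisation R {m} using (disc≈0⇔)
  open FamilyBounds R {m} using (weight-sum≤4; cardinality≤4)
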